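{- Let $H$ be a finite graph that has an even decomposition. Then there exists $c_H>0$ such that for all sufficiently large $n$, $r_H(n)\geq n^{c_H}$, and hence $d^{\mathrm{lin}}_H(n)\leq n^{ -c_H}$. More precisely, if $H$ has $v(H)\geq 3$ vertices, then for every $\varepsilon>0$ and all sufficiently large $n$, $r_H(n)\geq (1-\varepsilon)n^{1/(v(H)-2)}$.
   Context: An even decomposition of a graph $H$ is a sequence of vertex sets $V(H)=V_0\supset V_1\supset\cdots\supset V_k=\emptyset$ such that for every $i\in[k]$, the set $V_{i-1}\setminus V_i$ is independent in $H$ and the number of edges of $H$ between $V_{i-1}\setminus V_i$ and $V_i$ is even. $K_n$ is the complete graph on $[n]$. An edge coloring $\chi$ of $K_n$ admits an even-chromatic copy of $H$ if there is an injective map $f\colon V(H)\to[n]$ such that every color appears on an even number (possibly zero) of the edges $f(u)f(v)$, $uv\in E(H)$. $r_H(n)$ is the minimum number of colors in an edge coloring of $K_n$ admitting no even-chromatic copy of $H$ ($\infty$ if none exists). Graphs on $[n]$ form the $\mathbb{F}_2$-vector space $\mathbb{F}_2^{K_n}$ with addition given by symmetric difference of edge sets; a graph $G$ on $[n]$ is a copy of $H$ if for some $S\subseteq[n]$, $G[S]\cong H$ and all vertices outside $S$ are isolated in $G$. $d^{\mathrm{lin}}_H(n)=2^{ -\binom n2}\max\{|\mathcal C|:\mathcal C\le\mathbb{F}_2^{K_n}\text{ a subspace containing no copy of }H\}$. -}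

module Defs where

open import Data.Nat using (ℕ; zero; suc; _+_; _*_; _∸_; _^_; _≤_; _<_; _<ᵇ_)
open import Data.Nat.Divisibility using (_∣_)
open import Data.Nat.Combinatorics using (_C_)
open import Data.Bool using (Bool; true; false; _∧_; _xor_; if_then_else_)
open import Data.Fin using (Fin; zero; suc; toℕ; fromℕ; inject₁; _≟_)
open import Data.Fin.Subset using (Subset; _⊆_; _─_) renaming (⊤ to fullSet; ⊥ to emptySet)
open import Data.Vec using (Vec; lookup; zipWith; replicate)
open import Data.List using (List; length)
open import Data.List.Membership.Propositional using (_∈_)
open import Data.List.Relation.Unary.All using (All)
open import Data.List.Relation.Unary.Unique.Propositional using (Unique)
open import Data.Product using (Σ; ∃; _×_)
open import Relation.Nullary using (does)
open import Relation.Binary.PropositionalEquality using (_≡_)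
open import Function.Definitions using (Injective)

record SimpleGraph : Set where
  field
    v     : ℕ
    adj   : Fin v → Fin v → Bool
    adj-sym : ∀ i j → adj i j ≡ adj j i
    adj-irr : ∀ i → adj i i ≡ false
open SimpleGraph public

b2n : Bool → ℕ
b2n true  = 1
b2n false = 0

sumFin : (n : ℕ) → (Fin n → ℕ) → ℕ
sumFin zero    f = 0
sumFin (suc n) f = f zero + sumFin n (λ i → f (suc i))

countOrdered : (n : ℕ) → (Fin n → Fin n → Bool) → ℕ
countOrdered n P = sumFin n (λ i → sumFin n (λ j → b2n (P i j)))

countUnordered : (n : ℕ) → (Fin n → Fin n → Bool) → ℕ
countUnordered n P = countOrdered n (λ i j → (toℕ i <ᵇ toℕ j) ∧ P i j)

Even : ℕ → Set
Even m = 2 ∣ m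

record EvenDecomposition (H : SimpleGraph) : Set where
  field
    len   : ℕ
    V     : Fin (suc len) → Subset (v H)
    start : V zero ≡ fullSet
    end   : V (fromℕ len) ≡ emptySet
    decr  : ∀ (i : Fin len) → V (suc i) ⊆ V (inject₁ i)
    indep : ∀ (i : Fin len) (x y : Fin (v H)) →
              lookup (V (inject₁ i) ─ V (suc i)) x ≡ true →
              lookup (V (inject₁ i) ─ V (suc i)) y ≡ true →
              adj H x y ≡ false
    even  : ∀ (i : Fin len) →
              Even (countOrdered (v H) (λ x y →
                 lookup (V (inject₁ i) ─ V (suc i)) x ∧
                 lookup (V (suc i)) y ∧ adj H x y))

-- Edge colourings of K_n with k colours: symmetric maps Fin n → Fin n → Fin k
-- (values on the diagonal are irrelevant).

SymmetricColouring : (n k : ℕ) → (Fin n → Fin n → Fin k) → Set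
SymmetricColouring n k χ = ∀ i j → χ i j ≡ χ j i

IsEvenChromaticCopy : (H : SimpleGraph) (n k : ℕ) →
  (Fin n → Fin n → Fin k) → (Fin (v H) → Fin n) → Set
IsEvenChromaticCopy H n k χ f =
  Injective _≡_ _≡_ f ×
  (∀ (c : Fin k) → Even (countUnordered (v H) (λ u w →
      adj H u w ∧ does (χ (f u) (f w) ≟ c))))

AdmitsEvenChromatic : (H : SimpleGraph) (n k : ℕ) → (Fin n → Fin n → Fin k) → Set
AdmitsEvenChromatic H n k χ = ∃ (λ f → IsEvenChromaticCopy H n k χ f)

-- "r_H(n) ≥ x" unfolded: every k-colouring of K_n with no even-chromatic
-- copy of H has k ≥ x.  The bound x is given via the predicate Big k.
rH-atLeast : (H : SimpleGraph) (n : ℕ) → (ℕ → Set) → Set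
rH-atLeast H n Big =
  ∀ (k : ℕ) (χ : Fin n → Fin n → Fin k) →
    SymmetricColouring n k χ → (AdmitsEvenChromatic H n k χ → Data.Empty.⊥) → Big k
  where import Data.Empty

Mat : ℕ → Set
Mat n = Vec (Vec Bool n) n

entry : ∀ {n} → Mat n → Fin n → Fin n → Bool
entry G i j = lookup (lookup G i) j

IsGraphOn : (n : ℕ) → Mat n → Set
IsGraphOn n G = (∀ i j → entry G i j ≡ entry G j i) × (∀ i → entry G i i ≡ false)

zeroGraph : (n : ℕ) → Mat n
zeroGraph n = replicate n (replicate n false)

_⊕_ : ∀ {n} → Mat n → Mat n → Mat n
G ⊕ G' = zipWith (zipWith _xor_) G G'

-- A (finite, hence listed without repetition) subspace of F₂^{K_n}.
record Subspace (n : ℕ) : Set where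
  field
    elems    : List (Mat n)
    distinct : Unique elems
    graphs   : All (IsGraphOn n) elems
    hasZero  : zeroGraph n ∈ elems
    closed   : ∀ {G G'} → G ∈ elems → G' ∈ elems → (G ⊕ G') ∈ elems
open Subspace public

IsCopy : (H : SimpleGraph) (n : ℕ) → Mat n → Set
IsCopy H n G =
  Σ (Fin (v H) → Fin n) λ f →
    Injective _≡_ _≡_ f ×
    (∀ u w → entry G (f u) (f w) ≡ adj H u w) ×
    (∀ i j → entry G i j ≡ true → ∃ (λ u → f u ≡ i) × ∃ (λ u → f u ≡ j))

CopyFree : (H : SimpleGraph) (n : ℕ) → Subspace n → Set
CopyFree H n C = ∀ G → G ∈ elems C → IsCopy H n G → Data.Empty.⊥
  where import Data.Empty

∣_∣ : ∀ {n} → Subspace n → ℕ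
∣ C ∣ = length (elems C)

edgesKn : ℕ → ℕ
edgesKn n = n C 2

{-# OPTIONS --safe #-}
-- Refine the even decomposition to parts of size one and two and embed the parts in order, shrinking
-- a candidate set U of vertices of K_n so that every embedded vertex sees all of U in one colour, the
-- same colour for both vertices of a pair. The edges from a part to what follows are then
-- monochromatic and even in number. A single vertex costs a factor k in |U| (majority colour) and a
-- pair a factor k² (averaging over pairs, by Cauchy–Schwarz), up to lower-order terms; the last two
-- vertices cost nothing, hence the exponent v(H) − 2. The terms lost are absorbed by letting the slack
-- |U| ≥ (1 + 1/b) k^(v−2) drop to 1 + 1/(b+1) at each step, for k large in terms of b.
-- For the linear statement, colour the edges by their cosets modulo the subspace.
module Submission where

open import Defs
open import Data.Bool using (Bool; true; false; _∧_; _xor_; not; T; T?; if_then_else_)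
import Data.Bool as Bool
open import Data.Bool.Properties using (T-≡; xor-comm; xor-same; ∧-comm)
open import Data.Empty using (⊥-elim)
open import Data.Fin using (Fin; zero; suc; inject₁; inject≤; fromℕ; combine)
import Data.Fin as Fin
open import Data.Fin.Properties using (combine-injective; injective⇒≤; inject≤-injective)
open import Data.Fin.Subset using (Subset; _─_; _⊆_) renaming (⊤ to fullSet; ⊥ to emptySet)
open import Data.List using (List; []; _∷_; _++_; map; length; filter; allFin; tabulate; cartesianProductWith)
import Data.List as List
open import Data.List.Membership.Propositional using (_∈_; _∉_; find; lose)
import Data.List.Membership.DecPropositional as DecMembership
open import Data.List.Membership.Propositional.Properties
  using (∈-allFin; ∈-filter⁻; ∈-tabulate⁺; ∈-cartesianProductWith⁺; ∈-cartesianProductWith⁻; ∈-map⁻; ∈-lookup)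
open import Data.List.Properties
  using (length-tabulate; filter-all; filter-none; map-tabulate; length-++; length-map; tabulate-lookup;
         ∷-injectiveˡ; ∷-injectiveʳ)
open import Data.List.Relation.Binary.Permutation.Propositional
  using (_↭_; refl; prep; swap; ↭-sym; ↭-reflexive; ↭⇒↭ₛ) renaming (trans to _then_)
open import Data.List.Relation.Binary.Permutation.Propositional.Properties
  using (shift; ++⁺ˡ; ↭-map-inv; map⁺; ↭-length)
import Data.List.Relation.Binary.Permutation.Setoid.Properties as Permutationₛ
open import Data.List.Relation.Unary.All using (All; []; _∷_)
import Data.List.Relation.Unary.All as All
open import Data.List.Relation.Unary.AllPairs using (AllPairs; []; _∷_)
open import Data.List.Relation.Unary.Any using (Any; here; there; any?; index)
open import Data.List.Relation.Unary.Any.Properties using (lookup-index)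
open import Data.List.Relation.Unary.Unique.Propositional using (Unique)
open import Data.List.Relation.Unary.Unique.Propositional.Properties using (allFin⁺; filter⁺)
import Data.List.Relation.Unary.Unique.Propositional.Properties as Unique
open import Data.Nat hiding (_≟_)
open import Data.Nat.Combinatorics using (nC1≡n; nCk+nC[k+1]≡[n+1]C[k+1])
open import Data.Nat.Divisibility using (_∣?_; divides; ∣m∣n⇒∣m+n; ∣m+n∣m⇒∣n; ∣n⇒∣m*n; _∣0; ∣-refl)
open import Data.Nat.Properties hiding (_≟_)
open import Data.Nat.Tactic.RingSolver using (solve-∀)
open import Data.Product using (Σ; ∃; ∃₂; _×_; _,_; proj₁; proj₂)
open import Data.Sum using (_⊎_; inj₁; inj₂)
open import Data.Vec using (Vec; lookup; []; _∷_)
import Data.Vec as Vec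
open import Data.Vec.Properties
  using (lookup-zipWith; lookup-replicate; lookup-map; lookup∘tabulate; tabulate∘lookup; tabulate-cong;
         lookup⇒[]=; []=⇒lookup; ++-injective; ≡-dec)
open import Function using (_∘_; id; Equivalence)
open import Function.Definitions using (Injective)
open import Relation.Binary.Definitions using (DecidableEquality)
open import Relation.Binary.PropositionalEquality
  using (_≡_; _≢_; refl; sym; trans; cong; cong₂; subst; subst₂; ≢-sym; setoid; module ≡-Reasoning)
open import Relation.Nullary using (¬_; Dec; yes; no; does; ¬?; _×-dec_)
open import Relation.Unary using (Decidable)

-- A pair is placed through two separate choices. Passing to twins makes each candidate see both
-- vertices in one colour, but that colour may vary with the candidate; a majority choice then fixes
-- it. Each choice costs a factor k. One common colour is needed because both degrees of a pair may
-- be odd: only their sum is known to be even, so the two stars must fall into the same colour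
-- class. The slack keeps the recursion alive. Each step loses, besides its factor, a term of lower
-- order: the placed vertex itself, or about k candidates for a pair. A bound of exactly k^e would
-- therefore not reproduce itself. Writing the slack as 1 + 1/b keeps all inequalities in ℕ, and as
-- the number of steps is bounded by v(H), only finitely many thresholds on k arise. Since two
-- vertices are free, a pair followed by exactly one vertex has a single factor k to spend. There
-- the order is reversed and the last vertex is placed before the pair.

private
  variable
    A B : Set

-- Finite sums

∑ : List A → (A → ℕ) → ℕ
∑ []       f = 0
∑ (x ∷ xs) f = f x + ∑ xs f

∑-cong : ∀ {f g : A → ℕ} xs → (∀ x → f x ≡ g x) → ∑ xs f ≡ ∑ xs g
∑-cong []       f≗g = refl
∑-cong (x ∷ xs) f≗g = cong₂ _+_ (f≗g x) (∑-cong xs f≗g)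

∑-mono : ∀ {f g : A → ℕ} xs → (∀ {x} → x ∈ xs → f x ≤ g x) → ∑ xs f ≤ ∑ xs g
∑-mono []       f≤g = z≤n
∑-mono (x ∷ xs) f≤g = +-mono-≤ (f≤g (here refl)) (∑-mono xs (f≤g ∘ there))

∑-cong-∈ : ∀ {f g : A → ℕ} xs → (∀ {x} → x ∈ xs → f x ≡ g x) → ∑ xs f ≡ ∑ xs g
∑-cong-∈ []       f≗g = refl
∑-cong-∈ (x ∷ xs) f≗g = cong₂ _+_ (f≗g (here refl)) (∑-cong-∈ xs (f≗g ∘ there))

∑-+ : ∀ (f g : A → ℕ) xs → ∑ xs (λ x → f x + g x) ≡ ∑ xs f + ∑ xs g
∑-+ f g []       = refl
∑-+ f g (x ∷ xs) rewrite ∑-+ f g xs = eq (f x) (g x) (∑ xs f) (∑ xs g)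
  where
  eq : ∀ a b c d → a + b + (c + d) ≡ a + c + (b + d)
  eq = solve-∀

∑-*ˡ : ∀ c (f : A → ℕ) xs → ∑ xs (λ x → c * f x) ≡ c * ∑ xs f
∑-*ˡ c f []       = sym (*-zeroʳ c)
∑-*ˡ c f (x ∷ xs) rewrite ∑-*ˡ c f xs = sym (*-distribˡ-+ c (f x) (∑ xs f))

∑-*ʳ : ∀ c (f : A → ℕ) xs → ∑ xs (λ x → f x * c) ≡ ∑ xs f * c
∑-*ʳ c f []       = refl
∑-*ʳ c f (x ∷ xs) rewrite ∑-*ʳ c f xs = sym (*-distribʳ-+ c (f x) (∑ xs f))

∑-const : ∀ c (xs : List A) → ∑ xs (λ _ → c) ≡ length xs * c
∑-const c []       = refl
∑-const c (x ∷ xs) = cong (c +_) (∑-const c xs)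

∑-0 : ∀ (xs : List A) → ∑ xs (λ _ → 0) ≡ 0
∑-0 xs = trans (∑-const 0 xs) (*-zeroʳ (length xs))

∑-swap : ∀ (f : A → B → ℕ) xs ys → ∑ xs (λ x → ∑ ys (f x)) ≡ ∑ ys (λ y → ∑ xs (λ x → f x y))
∑-swap f []       ys = sym (∑-0 ys)
∑-swap f (x ∷ xs) ys = trans (cong (∑ ys (f x) +_) (∑-swap f xs ys))
                             (sym (∑-+ (f x) (λ y → ∑ xs (λ x′ → f x′ y)) ys))

∑-map : ∀ (f : B → ℕ) (h : A → B) xs → ∑ (map h xs) f ≡ ∑ xs (f ∘ h)
∑-map f h []       = refl
∑-map f h (x ∷ xs) = cong (f (h x) +_) (∑-map f h xs)

∑-++ : ∀ (f : A → ℕ) xs ys → ∑ (xs ++ ys) f ≡ ∑ xs f + ∑ ys f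
∑-++ f []       ys = refl
∑-++ f (x ∷ xs) ys = trans (cong (f x +_) (∑-++ f xs ys)) (sym (+-assoc (f x) _ _))

∑-↭ : ∀ (f : A → ℕ) {xs ys} → xs ↭ ys → ∑ xs f ≡ ∑ ys f
∑-↭ f refl          = refl
∑-↭ f (prep x p)    = cong (f x +_) (∑-↭ f p)
∑-↭ f (swap {ys = ys} x y p) rewrite ∑-↭ f p = eq (f x) (f y) (∑ ys f)
  where
  eq : ∀ a b c → a + (b + c) ≡ b + (a + c)
  eq = solve-∀
∑-↭ f (p then q)    = trans (∑-↭ f p) (∑-↭ f q)

b2n-∧ : ∀ x y → b2n (x ∧ y) ≡ b2n x * b2n y
b2n-∧ true  y = sym (+-identityʳ _)
b2n-∧ false y = refl

∑-even : ∀ {f : A → ℕ} xs → (∀ x → Even (f x)) → Even (∑ xs f)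
∑-even []       e = 2 ∣0
∑-even (x ∷ xs) e = ∣m∣n⇒∣m+n (e x) (∑-even xs e)

length-filter-∑ : ∀ {P : A → Set} (P? : Decidable P) xs →
                  length (filter P? xs) ≡ ∑ xs (b2n ∘ does ∘ P?)
length-filter-∑ P? []       = refl
length-filter-∑ P? (x ∷ xs) with does (P? x)
... | true  = cong suc (length-filter-∑ P? xs)
... | false = length-filter-∑ P? xs

∑-filter : ∀ (f : A → ℕ) {P : A → Set} (P? : Decidable P) xs →
           ∑ (filter P? xs) f ≡ ∑ xs (λ x → b2n (does (P? x)) * f x)
∑-filter f P? []       = refl
∑-filter f P? (x ∷ xs) with does (P? x)
... | true  = cong₂ _+_ (sym (+-identityʳ (f x))) (∑-filter f P? xs)
... | false = ∑-filter f P? xs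

does-refl : (_≟_ : DecidableEquality A) (x : A) → does (x ≟ x) ≡ true
does-refl _≟_ x with x ≟ x
... | yes _  = refl
... | no x≢x = ⊥-elim (x≢x refl)

module _ (_≟_ : DecidableEquality A) where

  ∑-δ-∉ : ∀ p (h : A → ℕ) {xs} → All (p ≢_) xs → ∑ xs (λ x → b2n (does (p ≟ x)) * h x) ≡ 0
  ∑-δ-∉ p h []                = refl
  ∑-δ-∉ p h {x ∷ _} (p≢x ∷ a) with p ≟ x
  ... | yes p≡x = ⊥-elim (p≢x p≡x)
  ... | no _    = ∑-δ-∉ p h a

  ∑-δ : ∀ p (h : A → ℕ) {xs} → Unique xs → p ∈ xs →
        ∑ xs (λ x → b2n (does (p ≟ x)) * h x) ≡ h p
  ∑-δ p h (x≢ ∷ _) (here refl) rewrite does-refl _≟_ p | ∑-δ-∉ p h x≢ =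
    trans (+-identityʳ _) (+-identityʳ _)
  ∑-δ p h {x ∷ _} (x≢ ∷ u) (there p∈) with p ≟ x
  ... | yes refl = ⊥-elim (All.lookup x≢ p∈ refl)
  ... | no _     = ∑-δ p h u p∈

sumFin-∑ : ∀ {A : Set} n (f : A → ℕ) (g : Fin n → A) → sumFin n (f ∘ g) ≡ ∑ (tabulate g) f
sumFin-∑ zero    f g = refl
sumFin-∑ (suc n) f g = cong (f (g zero) +_) (sumFin-∑ n f (g ∘ suc))

sumFin-cong : ∀ n {f g : Fin n → ℕ} → (∀ i → f i ≡ g i) → sumFin n f ≡ sumFin n g
sumFin-cong zero    e = refl
sumFin-cong (suc n) e = cong₂ _+_ (e zero) (sumFin-cong n (e ∘ suc))

-- Sums over unordered pairs

pairs : List A → List (A × A)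
pairs []       = []
pairs (x ∷ xs) = map (x ,_) xs ++ pairs xs

∑-pairs-∷ : ∀ (g : A × A → ℕ) x xs → ∑ (pairs (x ∷ xs)) g ≡ ∑ xs (λ y → g (x , y)) + ∑ (pairs xs) g
∑-pairs-∷ g x xs = trans (∑-++ g (map (x ,_) xs) (pairs xs))
                         (cong (_+ ∑ (pairs xs) g) (∑-map g (x ,_) xs))

pairs-map : ∀ (h : A → B) xs → pairs (map h xs) ≡ map (λ (x , y) → h x , h y) (pairs xs)
pairs-map h []       = refl
pairs-map h (x ∷ xs) rewrite pairs-map h xs = eq xs
  where
  k : _ × _ → _ × _
  k (x , y) = h x , h y
  eq : ∀ ys → map (h x ,_) (map h ys) ++ map k (pairs xs) ≡ map k (map (x ,_) ys ++ pairs xs)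
  eq []       = refl
  eq (y ∷ ys) = cong (_ ∷_) (eq ys)

-- Needed because an embedding lists vertices in peeling order, whereas `countUnordered` uses the
-- order of indices. A permutation may flip the two entries of a pair, hence the symmetry of `g`.
∑-pairs-↭ : ∀ (g : A × A → ℕ) → (∀ x y → g (x , y) ≡ g (y , x)) →
            ∀ {xs ys} → xs ↭ ys → ∑ (pairs xs) g ≡ ∑ (pairs ys) g
∑-pairs-↭ g g-sym refl = refl
∑-pairs-↭ g g-sym (prep {xs} {ys} x p)
  rewrite ∑-pairs-∷ g x xs | ∑-pairs-∷ g x ys = cong₂ _+_ (∑-↭ _ p) (∑-pairs-↭ g g-sym p)
∑-pairs-↭ g g-sym (swap {xs} {ys} x y p)
  rewrite ∑-pairs-∷ g x (y ∷ xs) | ∑-pairs-∷ g y xs | ∑-pairs-∷ g y (x ∷ ys) | ∑-pairs-∷ g x ys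
        | g-sym x y | ∑-↭ (λ z → g (x , z)) p | ∑-↭ (λ z → g (y , z)) p | ∑-pairs-↭ g g-sym p
  = eq (g (y , x)) _ _ _
  where
  eq : ∀ a b c d → a + b + (c + d) ≡ a + c + (b + d)
  eq = solve-∀
∑-pairs-↭ g g-sym (p then q) = trans (∑-pairs-↭ g g-sym p) (∑-pairs-↭ g g-sym q)

-- Turns a sum over pairs, read in both orientations, into a full double sum, in which indicator
-- factors can be summed out one variable at a time.
∑-pairs-handshake : ∀ (g : A → A → ℕ) xs →
  ∑ xs (λ x → ∑ xs (g x)) ≡ ∑ (pairs xs) (λ (x , y) → g x y + g y x) + ∑ xs (λ x → g x x)
∑-pairs-handshake g []       = refl
∑-pairs-handshake g (x ∷ xs)
  rewrite ∑-pairs-∷ (λ (x , y) → g x y + g y x) x xs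
        | ∑-+ (g x) (λ y → g y x) xs
        | ∑-+ (λ y → g y x) (λ y → ∑ xs (g y)) xs
        | ∑-pairs-handshake g xs
  = eq (g x x) _ _ _ _
  where
  eq : ∀ a b c d e → a + b + (c + (d + e)) ≡ b + c + d + (a + e)
  eq = solve-∀

countUnordered-pairs : ∀ n (P : Fin n → Fin n → Bool) →
  countUnordered n P ≡ ∑ (pairs (allFin n)) (λ (i , j) → b2n (P i j))
countUnordered-pairs n P = go n (λ i j → P i j) id
  where
  -- An arbitrary labelling `h` lets the induction drop vertex zero and continue with `h ∘ suc`.
  go : ∀ {A : Set} m (Q : A → A → Bool) (h : Fin m → A) →
    countUnordered m (λ i j → Q (h i) (h j)) ≡ ∑ (pairs (tabulate h)) (λ (i , j) → b2n (Q i j))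
  go zero    Q h = refl
  go (suc m) Q h = trans
    (cong₂ _+_ (sumFin-∑ m (λ y → b2n (Q (h zero) y)) (h ∘ suc)) (go m Q (h ∘ suc)))
    (sym (∑-pairs-∷ (λ (i , j) → b2n (Q i j)) (h zero) (tabulate (h ∘ suc))))

-- Monochromatic neighbourhoods

∑-average : ∀ (f : A → ℕ) x xs → ∃ λ y → ∑ (x ∷ xs) f ≤ length (x ∷ xs) * f y
∑-average f x []        = x , ≤-refl
∑-average f x (x′ ∷ xs) with ∑-average f x′ xs
... | y , ≤y with ≤-total (f x) (f y)
... | inj₁ x≤y = y , +-mono-≤ x≤y ≤y
... | inj₂ y≤x = x , +-monoʳ-≤ (f x) (≤-trans ≤y (*-monoʳ-≤ (length (x′ ∷ xs)) y≤x))

2xy≤x²+y² : ∀ x y → 2 * (x * y) ≤ x * x + y * y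
2xy≤x²+y² x y with ≤-total x y
... | inj₁ x≤y with m≤n⇒∃[o]m+o≡n x≤y
... | d , refl = m+n≤o⇒m≤o _ (≤-reflexive (eq x d))
  where
  eq : ∀ x d → 2 * (x * (x + d)) + d * d ≡ x * x + (x + d) * (x + d)
  eq = solve-∀
2xy≤x²+y² x y | inj₂ y≤x with m≤n⇒∃[o]m+o≡n y≤x
... | d , refl = m+n≤o⇒m≤o _ (≤-reflexive (eq y d))
  where
  eq : ∀ y d → 2 * ((y + d) * y) + d * d ≡ (y + d) * (y + d) + y * y
  eq = solve-∀

-- Cauchy-Schwarz against the constant 1. In the induction the mixed term 2aS is spread over the
-- tail, where each 2a · `f y` is at most a² + (`f y`)².
∑-square-≤ : ∀ (f : A → ℕ) xs → ∑ xs f * ∑ xs f ≤ length xs * ∑ xs (λ x → f x * f x)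
∑-square-≤ f []       = z≤n
∑-square-≤ f (x ∷ xs) = begin
  (a + S) * (a + S)                        ≡⟨ eq₁ a S ⟩
  a * a + 2 * (a * S) + S * S              ≤⟨ +-mono-≤ (+-monoʳ-≤ (a * a) cross) (∑-square-≤ f xs) ⟩
  a * a + (l * (a * a) + Q) + l * Q        ≡⟨ eq₂ a l Q ⟩
  suc l * (a * a + Q)                      ∎
  where
  open ≤-Reasoning
  a = f x
  S = ∑ xs f
  l = length xs
  Q = ∑ xs (λ x → f x * f x)
  eq₁ : ∀ a S → (a + S) * (a + S) ≡ a * a + 2 * (a * S) + S * S
  eq₁ = solve-∀
  eq₂ : ∀ a l Q → a * a + (l * (a * a) + Q) + l * Q ≡ (1 + l) * (a * a + Q)
  eq₂ = solve-∀
  cross : 2 * (a * S) ≤ l * (a * a) + Q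
  cross = begin
    2 * (a * S)                             ≡⟨ cong (2 *_) (∑-*ˡ a f xs) ⟨
    2 * ∑ xs (λ y → a * f y)                ≡⟨ ∑-*ˡ 2 _ xs ⟨
    ∑ xs (λ y → 2 * (a * f y))              ≤⟨ ∑-mono xs (λ {y} _ → 2xy≤x²+y² a (f y)) ⟩
    ∑ xs (λ y → a * a + f y * f y)          ≡⟨ ∑-+ (λ _ → a * a) _ xs ⟩
    ∑ xs (λ _ → a * a) + Q                  ≡⟨ cong (_+ Q) (∑-const (a * a) xs) ⟩
    l * (a * a) + Q                         ∎

module _ {k : ℕ} where

  δ : Fin k → Fin k → ℕ
  δ i c = b2n (does (i Fin.≟ c))

  ∑-δ-allFin : ∀ i (h : Fin k → ℕ) → ∑ (allFin k) (λ c → δ i c * h c) ≡ h i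
  ∑-δ-allFin i h = ∑-δ Fin._≟_ i h (allFin⁺ k) (∈-allFin i)

  ∑-by-colour : ∀ (φ : A → Fin k) (p : A → ℕ) U →
    ∑ (allFin k) (λ c → ∑ U (λ a → δ (φ a) c * p a)) ≡ ∑ U p
  ∑-by-colour φ p U = trans (∑-swap (λ c a → δ (φ a) c * p a) (allFin k) U)
                            (∑-cong U λ a → ∑-δ-allFin (φ a) (λ _ → p a))

  -- The double sum is the sum over all colours of the squared weight of the colour class. The
  -- weights `p` later serve to exclude one vertex from `U`.
  cauchy-schwarz : ∀ (φ : A → Fin k) (p : A → ℕ) U →
    ∑ U p * ∑ U p ≤ k * ∑ U (λ a → ∑ U (λ a′ → p a * p a′ * δ (φ a′) (φ a)))
  cauchy-schwarz φ p U = begin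
    ∑ U p * ∑ U p                              ≡⟨ cong₂ _*_ (∑-by-colour φ p U) (∑-by-colour φ p U) ⟨
    ∑ (allFin k) e * ∑ (allFin k) e            ≤⟨ ∑-square-≤ e (allFin k) ⟩
    length (allFin k) * ∑ (allFin k) (λ c → e c * e c)
                                               ≡⟨ cong₂ _*_ (length-tabulate {n = k} id) square ⟩
    k * ∑ U (λ a → ∑ U (λ a′ → p a * p a′ * δ (φ a′) (φ a))) ∎
    where
    open ≤-Reasoning
    e : Fin k → ℕ
    e c = ∑ U (λ a → δ (φ a) c * p a)
    eq : ∀ d p d′ p′ → d * p * (d′ * p′) ≡ d * (p * p′ * d′)
    eq = solve-∀
    square : ∑ (allFin k) (λ c → e c * e c) ≡ ∑ U (λ a → ∑ U (λ a′ → p a * p a′ * δ (φ a′) (φ a)))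
    square = begin-equality
      ∑ (allFin k) (λ c → e c * e c)
        ≡⟨ ∑-cong (allFin k) (λ c → ∑-*ʳ (e c) _ U) ⟨
      ∑ (allFin k) (λ c → ∑ U (λ a → δ (φ a) c * p a * e c))
        ≡⟨ ∑-cong (allFin k) (λ c → ∑-cong U λ a → trans (sym (∑-*ˡ (δ (φ a) c * p a) _ U))
             (∑-cong U λ a′ → eq (δ (φ a) c) (p a) (δ (φ a′) c) (p a′))) ⟩
      ∑ (allFin k) (λ c → ∑ U (λ a → ∑ U (λ a′ → δ (φ a) c * (p a * p a′ * δ (φ a′) c))))
        ≡⟨ ∑-swap _ (allFin k) U ⟩
      ∑ U (λ a → ∑ (allFin k) (λ c → ∑ U (λ a′ → δ (φ a) c * (p a * p a′ * δ (φ a′) c))))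
        ≡⟨ ∑-cong U (λ a → ∑-swap _ (allFin k) U) ⟩
      ∑ U (λ a → ∑ U (λ a′ → ∑ (allFin k) (λ c → δ (φ a) c * (p a * p a′ * δ (φ a′) c))))
        ≡⟨ ∑-cong U (λ a → ∑-cong U λ a′ → ∑-δ-allFin (φ a) (λ c → p a * p a′ * δ (φ a′) c)) ⟩
      ∑ U (λ a → ∑ U (λ a′ → p a * p a′ * δ (φ a′) (φ a))) ∎

majority : ∀ {k} (φ : A → Fin (suc k)) U →
  ∃ λ c → length U ≤ suc k * length (filter (λ a → φ a Fin.≟ c) U)
-- `allFin (suc k)` unfolds to `zero ∷ tabulate suc`, the visibly nonempty list that averaging asks
-- for.
majority {k = k} φ U with ∑-average (λ c → ∑ U (λ a → δ (φ a) c * 1)) zero (tabulate suc)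
... | c , bound = c , (begin
  length U                                                 ≡⟨ *-identityʳ _ ⟨
  length U * 1                                             ≡⟨ ∑-const 1 U ⟨
  ∑ U (λ _ → 1)                                            ≡⟨ ∑-by-colour φ (λ _ → 1) U ⟨
  ∑ (allFin (suc k)) (λ c → ∑ U (λ a → δ (φ a) c * 1))     ≤⟨ bound ⟩
  length (allFin (suc k)) * ∑ U (λ a → δ (φ a) c * 1)
    ≡⟨ cong₂ _*_ (length-tabulate {n = suc k} id) (∑-cong U (λ a → *-identityʳ (δ (φ a) c))) ⟩
  suc k * ∑ U (λ a → δ (φ a) c)
    ≡⟨ cong (suc k *_) (length-filter-∑ (λ a → φ a Fin.≟ c) U) ⟨
  suc k * length (filter (λ a → φ a Fin.≟ c) U)            ∎)
  where open ≤-Reasoning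

-- Pairs that many vertices see in one colour

module _ {X : Set} (_≟_ : DecidableEquality X) where

  does-sym : ∀ x y → does (x ≟ y) ≡ does (y ≟ x)
  does-sym x y with x ≟ y | y ≟ x
  ... | yes _   | yes _   = refl
  ... | no _    | no _    = refl
  ... | yes x≡y | no y≢x  = ⊥-elim (y≢x (sym x≡y))
  ... | no x≢y  | yes y≡x = ⊥-elim (x≢y (sym y≡x))

  ∑-≢ : ∀ {U} → Unique U → ∀ {x} → x ∈ U → ∑ U (λ y → b2n (not (does (x ≟ y)))) + 1 ≡ length U
  ∑-≢ {U} U! {x} x∈U = begin
    ∑ U (λ y → b2n (not (does (x ≟ y)))) + 1
      ≡⟨ cong (∑ U _ +_) (∑-δ _≟_ x (λ _ → 1) U! x∈U) ⟨
    ∑ U (λ y → b2n (not (does (x ≟ y)))) + ∑ U (λ y → b2n (does (x ≟ y)) * 1)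
      ≡⟨ ∑-+ _ _ U ⟨
    ∑ U (λ y → b2n (not (does (x ≟ y))) + b2n (does (x ≟ y)) * 1)
      ≡⟨ ∑-cong U (λ y → complement (does (x ≟ y))) ⟩
    ∑ U (λ _ → 1)
      ≡⟨ trans (∑-const 1 U) (*-identityʳ _) ⟩
    length U ∎
    where
    open ≡-Reasoning
    complement : ∀ b → b2n (not b) + b2n b * 1 ≡ 1
    complement true  = refl
    complement false = refl

  module _ {k : ℕ} (χ : X → X → Fin (suc k)) where

    -- The common colour may still depend on `w`. The inequalities keep the meaningless diagonal
    -- values of `χ` out.
    Twin : X → X → X → Set
    Twin a a′ w = ¬ a ≡ w × ¬ a′ ≡ w × χ a′ w ≡ χ a w

    twin? : ∀ a a′ → Decidable (Twin a a′)
    twin? a a′ w = ¬? (a ≟ w) ×-dec ¬? (a′ ≟ w) ×-dec (χ a′ w Fin.≟ χ a w)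

    private
      p : X → X → ℕ
      p w a = b2n (not (does (a ≟ w)))

      b2n-twin : ∀ a a′ w → b2n (does (twin? a a′ w)) ≡ p w a * p w a′ * δ (χ a′ w) (χ a w)
      b2n-twin a a′ w = trans (b2n-∧ (not (does (a ≟ w))) _)
        (trans (cong (p w a *_) (b2n-∧ (not (does (a′ ≟ w))) _)) (sym (*-assoc (p w a) _ _)))

    -- Average over all pairs a ≠ a′: for each w, Cauchy–Schwarz bounds from below the number of
    -- pairs that w sees in one colour.
    many-twins : ∀ {U} → Unique U → 2 ≤ length U →
      ∃₂ λ a a′ → a ∈ U × a′ ∈ U × ¬ a ≡ a′ ×
        length U ≤ suc k * length (filter (twin? a a′) U) + suc (suc k)
    many-twins {U} U! 2≤u
      with any? (λ a → any? (λ a′ → ¬? (a ≟ a′) ×-dec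
             (length U ≤? suc k * length (filter (twin? a a′) U) + suc (suc k))) U) U
    ... | yes found with find found
    ... | a , a∈U , found′ with find found′
    ... | a′ , a′∈U , a≢a′ , bound = a , a′ , a∈U , a′∈U , a≢a′ , bound
    many-twins {U} U! 2≤u | no none with length U in ∣U∣≡
    many-twins U! (s≤s ()) | no none | suc zero
    many-twins {U} U! 2≤u | no none | suc (suc m) = ⊥-elim (m+1+n≰m (u * u + slack) absurd)
      where
      open ≤-Reasoning
      u u′ : ℕ
      u  = 2 + m
      u′ = 1 + m
      M : X → X → ℕ
      M a a′ = length (filter (twin? a a′) U)
      M-∑ : ∀ a a′ → M a a′ ≡ ∑ U (λ w → p w a * p w a′ * δ (χ a′ w) (χ a w))
      M-∑ a a′ = trans (length-filter-∑ (twin? a a′) U) (∑-cong U (b2n-twin a a′))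
      total : ℕ
      total = ∑ U (λ a → ∑ U (M a))
      ∑-const-U : ∀ c → ∑ U (λ _ → c) ≡ u * c
      ∑-const-U c = trans (∑-const c U) (cong (_* c) ∣U∣≡)
      degree : ∀ {a} → a ∈ U → ∑ U (λ w → p w a) ≡ u′
      degree a∈U = +-cancelʳ-≡ 1 _ _ (trans (trans (∑-≢ U! a∈U) ∣U∣≡) (+-comm 1 u′))
      degree′ : ∀ {w} → w ∈ U → ∑ U (p w) ≡ u′
      degree′ {w} w∈U = trans (∑-cong U (λ a → cong (b2n ∘ not) (does-sym a w))) (degree w∈U)
      lower : u * (u′ * u′) ≤ suc k * total
      lower = begin
        u * (u′ * u′)              ≡⟨ ∑-const-U (u′ * u′) ⟨
        ∑ U (λ _ → u′ * u′)        ≤⟨ ∑-mono U (λ {w} w∈U → ≤-trans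
                                        (≤-reflexive (cong₂ _*_ (sym (degree′ w∈U)) (sym (degree′ w∈U))))
                                        (cauchy-schwarz (λ a → χ a w) (p w) U)) ⟩
        ∑ U (λ w → suc k * ∑ U (λ a → ∑ U (λ a′ → p w a * p w a′ * δ (χ a′ w) (χ a w))))
                                   ≡⟨ ∑-*ˡ (suc k) _ U ⟩
        suc k * ∑ U (λ w → ∑ U (λ a → ∑ U (λ a′ → p w a * p w a′ * δ (χ a′ w) (χ a w))))
                                   ≡⟨ cong (suc k *_) (trans (∑-swap _ U U) (∑-cong U λ a →
                                        trans (∑-swap _ U U) (∑-cong U λ a′ → sym (M-∑ a a′)))) ⟩
        suc k * total                  ∎
      M-diagonal : ∀ {a} → a ∈ U → M a a ≤ u′
      M-diagonal {a} a∈U = begin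
        M a a                                            ≡⟨ length-filter-∑ (twin? a a) U ⟩
        ∑ U (λ w → b2n (does (twin? a a w)))             ≤⟨ ∑-mono U (λ {w} _ → b2n-∧-≤ (not (does (a ≟ w))) _) ⟩
        ∑ U (λ w → p w a)                                ≡⟨ degree a∈U ⟩
        u′                                               ∎
        where
        b2n-∧-≤ : ∀ x y → b2n (x ∧ y) ≤ b2n x
        b2n-∧-≤ true  true  = ≤-refl
        b2n-∧-≤ true  false = z≤n
        b2n-∧-≤ false y     = z≤n
      -- Cauchy-Schwarz counts the diagonal pairs a = a′ too. Bounded trivially by `u′` twins, such
      -- a pair exceeds the bound for the others by exactly `slack`.
      slack : ℕ
      slack = k * u + 2
      pointwise : ∀ {a a′} → a ∈ U → a′ ∈ U →
        suc k * M a a′ + (3 + k) ≤ u + b2n (does (a ≟ a′)) * slack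
      pointwise {a} {a′} a∈U a′∈U with a ≟ a′
      ... | yes refl = begin
        suc k * M a a + (3 + k)     ≤⟨ +-monoˡ-≤ (3 + k) (*-monoʳ-≤ (suc k) (M-diagonal a∈U)) ⟩
        suc k * u′ + (3 + k)        ≡⟨ eq k m ⟩
        u + 1 * slack                   ∎
        where
        eq : ∀ k m → (1 + k) * (1 + m) + (3 + k) ≡ (2 + m) + 1 * (k * (2 + m) + 2)
        eq = solve-∀
      ... | no a≢a′  = begin
        suc k * M a a′ + (3 + k)              ≡⟨ +-suc _ _ ⟩
        suc (suc k * M a a′ + suc (suc k))    ≤⟨ ≰⇒> (λ le → none (lose a∈U (lose a′∈U (a≢a′ , le)))) ⟩
        u                                     ≡⟨ +-identityʳ u ⟨
        u + 0                                 ∎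
      upper : suc k * total + u * (u * (3 + k)) ≤ u * (u * u) + u * slack
      upper = begin
        suc k * total + u * (u * (3 + k))
          ≡⟨ cong₂ _+_ (sym (trans (∑-cong U (λ a → ∑-*ˡ (suc k) (M a) U)) (∑-*ˡ (suc k) _ U)))
               (sym (trans (∑-cong U (λ _ → ∑-const-U (3 + k))) (∑-const-U _))) ⟩
        ∑ U (λ a → ∑ U (λ a′ → suc k * M a a′)) + ∑ U (λ a → ∑ U (λ a′ → 3 + k))
          ≡⟨ trans (∑-cong U (λ a → ∑-+ (λ a′ → suc k * M a a′) (λ _ → 3 + k) U)) (∑-+ _ _ U) ⟨
        ∑ U (λ a → ∑ U (λ a′ → suc k * M a a′ + (3 + k)))
          ≤⟨ ∑-mono U (λ a∈U → ∑-mono U (λ a′∈U → pointwise a∈U a′∈U)) ⟩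
        ∑ U (λ a → ∑ U (λ a′ → u + b2n (does (a ≟ a′)) * slack))
          ≡⟨ ∑-cong-∈ U (λ {a} a∈U → trans (∑-+ (λ _ → u) (λ a′ → b2n (does (a ≟ a′)) * slack) U)
               (cong₂ _+_ (∑-const-U u) (∑-δ _≟_ a (λ _ → slack) U! a∈U))) ⟩
        ∑ U (λ _ → u * u + slack)
          ≡⟨ ∑-const-U _ ⟩
        u * (u * u + slack)
          ≡⟨ *-distribˡ-+ u (u * u) slack ⟩
        u * (u * u) + u * slack ∎
      -- After one factor `u` is cancelled, `lower` contributes (u - 1)² and (u - 1)² + u(k + 3)
      -- exceeds u² + `slack` by u - 1 = `suc m`.
      absurd : u * u + slack + suc m ≤ u * u + slack
      absurd = *-cancelˡ-≤ u (begin
        u * (u * u + slack + suc m)                   ≡⟨ eq k m ⟩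
        u * (u′ * u′) + u * (u * (3 + k))         ≤⟨ +-monoˡ-≤ _ lower ⟩
        suc k * total + u * (u * (3 + k))             ≤⟨ upper ⟩
        u * (u * u) + u * slack                       ≡⟨ *-distribˡ-+ u (u * u) slack ⟨
        u * (u * u + slack)                           ∎)
        where
        eq : ∀ k m → (2 + m) * ((2 + m) * (2 + m) + (k * (2 + m) + 2) + (1 + m)) ≡
                     (2 + m) * ((1 + m) * (1 + m)) + (2 + m) * ((2 + m) * (3 + k))
        eq = solve-∀

-- Embedding along a peeling

-- The slack is strictly above 1, which already rules out a candidate set of size at most one; the
-- base cases and `many-twins` need two candidates.
large⇒2≤ : ∀ b {x y} .{{_ : NonZero x}} → suc b * x ≤ b * y → 2 ≤ y
large⇒2≤ b {x} {y} h = ≰⇒> λ y≤1 → <⇒≱ (n<1+n b) (begin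
  suc b        ≤⟨ m≤m*n (suc b) x ⟩
  suc b * x    ≤⟨ h ⟩
  b * y        ≤⟨ *-monoʳ-≤ b y≤1 ⟩
  b * 1        ≡⟨ *-identityʳ b ⟩
  b            ∎)
  where open ≤-Reasoning

-- Passing from 1 + 1/b to 1 + 1/(b + 1) frees a share 1/(b(b + 1)), which must outweigh the one
-- vertex lost; hence the threshold b(b + 1) < k. In integers, (b + 1)² exceeds b(b + 2) by one, and
-- that leftover copy of k · k^e would have to be at most b(b + 1).
single-step-bound : ∀ b k e u w → b * suc b < k → suc b * k ^ suc e ≤ b * suc u → u ≤ k * w →
                    suc (suc b) * k ^ e ≤ suc b * w
single-step-bound b k e u w K≤k large u≤kw = ≮⇒≥ λ small →
  <⇒≱ K≤k (≤-trans (m≤m*n k P) (m+n≤o⇒m≤o (k * P) (+-cancelˡ-≤ (b * (2 + b) * (k * P)) _ _ (begin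
    b * (2 + b) * (k * P) + (k * P + b * k)
      ≡⟨ eq₁ b k P ⟩
    suc b * (suc b * (k * P)) + b * k
      ≤⟨ +-monoˡ-≤ (b * k) (*-monoʳ-≤ (suc b) large) ⟩
    suc b * (b * suc u) + b * k
      ≤⟨ +-monoˡ-≤ (b * k) (*-monoʳ-≤ (suc b) (*-monoʳ-≤ b (s≤s u≤kw))) ⟩
    suc b * (b * suc (k * w)) + b * k
      ≡⟨ eq₂ b k w ⟩
    b * k * suc (suc b * w) + b * suc b
      ≤⟨ +-monoˡ-≤ (b * suc b) (*-monoʳ-≤ (b * k) small) ⟩
    b * k * (suc (suc b) * P) + b * suc b
      ≡⟨ eq₃ b k P ⟩
    b * (2 + b) * (k * P) + b * suc b ∎))))
  where
  open ≤-Reasoning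
  P = k ^ e
  instance
    k≢0 : NonZero k
    k≢0 = >-nonZero (≤-<-trans z≤n K≤k)
    P≢0 : NonZero P
    P≢0 = m^n≢0 k e
  eq₁ : ∀ b k P → b * (2 + b) * (k * P) + (k * P + b * k) ≡ (1 + b) * ((1 + b) * (k * P)) + b * k
  eq₁ = solve-∀
  eq₂ : ∀ b k w → (1 + b) * (b * (1 + k * w)) + b * k ≡ b * k * (1 + (1 + b) * w) + b * (1 + b)
  eq₂ = solve-∀
  eq₃ : ∀ b k P → b * k * ((2 + b) * P) + b * (1 + b) ≡ b * (2 + b) * (k * P) + b * (1 + b)
  eq₃ = solve-∀

-- The same comparison with k² in place of k. The loss is now k + 1 candidates, so the leftover k² ·
-- k^e is set against b(b + 1)(k + 1).
double-step-bound : ∀ b k e u m w → b * suc b < k → suc b * k ^ suc (suc e) ≤ b * u →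
                    u ≤ k * m + suc k → m ≤ k * w → suc (suc b) * k ^ e ≤ suc b * w
double-step-bound b k e u m w K≤k large u≤ m≤kw = ≮⇒≥ λ small →
  <⇒≱ k²-large (≤-trans (m≤m*n (k * k) P) (m+n≤o⇒m≤o (k * k * P)
    (+-cancelˡ-≤ (b * (2 + b) * (k * k * P)) _ _ (begin
    b * (2 + b) * (k * k * P) + (k * k * P + b * (k * k))
      ≡⟨ eq₁ b k P ⟩
    suc b * (suc b * (k * (k * P))) + b * (k * k)
      ≤⟨ +-monoˡ-≤ (b * (k * k)) (*-monoʳ-≤ (suc b) large) ⟩
    suc b * (b * u) + b * (k * k)
      ≤⟨ +-monoˡ-≤ (b * (k * k)) (*-monoʳ-≤ (suc b) (*-monoʳ-≤ b
           (≤-trans u≤ (+-monoˡ-≤ (suc k) (*-monoʳ-≤ k m≤kw))))) ⟩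
    suc b * (b * (k * (k * w) + suc k)) + b * (k * k)
      ≡⟨ eq₂ b k w ⟩
    b * (k * k) * suc (suc b * w) + b * suc b * suc k
      ≤⟨ +-monoˡ-≤ (b * suc b * suc k) (*-monoʳ-≤ (b * (k * k)) small) ⟩
    b * (k * k) * (suc (suc b) * P) + b * suc b * suc k
      ≡⟨ eq₃ b k P ⟩
    b * (2 + b) * (k * k * P) + b * suc b * suc k ∎))))
  where
  open ≤-Reasoning
  P = k ^ e
  instance
    k≢0 : NonZero k
    k≢0 = >-nonZero (≤-<-trans z≤n K≤k)
    P≢0 : NonZero P
    P≢0 = m^n≢0 k e
  eq₁ : ∀ b k P → b * (2 + b) * (k * k * P) + (k * k * P + b * (k * k)) ≡
                  (1 + b) * ((1 + b) * (k * (k * P))) + b * (k * k)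
  eq₁ = solve-∀
  eq₂ : ∀ b k w → (1 + b) * (b * (k * (k * w) + (1 + k))) + b * (k * k) ≡
                  b * (k * k) * (1 + (1 + b) * w) + b * (1 + b) * (1 + k)
  eq₂ = solve-∀
  eq₃ : ∀ b k P → b * (k * k) * ((2 + b) * P) + b * (1 + b) * (1 + k) ≡
                  b * (2 + b) * (k * k * P) + b * (1 + b) * (1 + k)
  eq₃ = solve-∀
  k²-large : b * suc b * suc k < k * k
  -- As b(b + 1) ≤ k - 1, the left side is at most (k - 1)(k + 1) = k² - 1, so the threshold of the
  -- single step suffices.
  k²-large with m≤n⇒∃[o]m+o≡n K≤k
  ... | d , refl = ≤-trans (s≤s (*-monoˡ-≤ (suc k) (m≤m+n (b * suc b) d))) (≤-reflexive (eq (b * suc b) d))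
    where
    eq : ∀ B d → 1 + (B + d) * (1 + (1 + B + d)) ≡ (1 + B + d) * (1 + B + d)
    eq = solve-∀

-- For a pair followed by one last vertex: only two vertices of a majority class are wanted, and one
-- factor k pays for them.
cherry-bound : ∀ b k u w → b < k → suc b * (k * 1) ≤ b * suc u → u ≤ k * w → 2 ≤ w
cherry-bound b k u w b<k large u≤kw = ≰⇒> λ w≤1 → <⇒≱ b<k (+-cancelˡ-≤ (b * k) _ _ (begin
  b * k + k           ≡⟨ eq b k ⟩
  suc b * (k * 1)     ≤⟨ large ⟩
  b * suc u           ≤⟨ *-monoʳ-≤ b (s≤s (≤-trans u≤kw (*-monoʳ-≤ k w≤1))) ⟩
  b * suc (k * 1)     ≡⟨ eq′ b k ⟩
  b * k + b           ∎))
  where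
  open ≤-Reasoning
  eq : ∀ b k → b * k + k ≡ (1 + b) * (k * 1)
  eq = solve-∀
  eq′ : ∀ b k → b * (1 + k * 1) ≡ b * k + b
  eq′ = solve-∀

module _ (H : SimpleGraph) where

  deg : Fin (v H) → List (Fin (v H)) → ℕ
  deg a ws = ∑ ws (λ w → b2n (adj H a w))

  -- An even decomposition refined to parts of size one and two: the vertices of odd degree in an
  -- independent part are even in number, so they can be paired up.
  data Peeling : List (Fin (v H)) → Set where
    []     : Peeling []
    single : ∀ {a ws} → Even (deg a ws) → Peeling ws → Peeling (a ∷ ws)
    double : ∀ {a a′ ws} → adj H a a′ ≡ false → Even (deg a ws + deg a′ ws) → Peeling ws →
             Peeling (a ∷ a′ ∷ ws)

  module _ {n k : ℕ} (χ : Fin n → Fin n → Fin (suc k)) where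

    edgeOf : Fin (suc k) → (Fin (v H) × Fin n) × (Fin (v H) × Fin n) → ℕ
    edgeOf c ((x , i) , (y , j)) = b2n (adj H x y ∧ does (χ i j Fin.≟ c))

    -- The map is stored as its graph, listed in peeling order, so that extending it is consing and
    -- the new edges are the first terms of `pairs`. A function on `Fin (v H)` is recovered only
    -- when all vertices are placed.
    record Embedding (L : List (Fin (v H))) (U : List (Fin n)) : Set where
      field
        graph   : List (Fin (v H) × Fin n)
        domain  : map proj₁ graph ≡ L
        unique  : Unique (map proj₂ graph)
        image   : ∀ {w} → w ∈ map proj₂ graph → w ∈ U
        even    : ∀ c → Even (∑ (pairs graph) (edgeOf c))
    open Embedding

    []-embedding : ∀ {U} → Embedding [] U
    []-embedding = record
      { graph = [] ; domain = refl ; unique = [] ; image = λ () ; even = λ c → 2 ∣0 }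

    -- The star lies wholly in colour `c₀`. The factor `δ c₀ c` covers both c = c₀ and c ≠ c₀, so an
    -- even degree gives an even count in every colour without a case distinction.
    monochromatic-star : ∀ a w₀ c₀ c ps → (∀ {w} → w ∈ map proj₂ ps → χ w₀ w ≡ c₀) →
      ∑ ps (λ q → edgeOf c ((a , w₀) , q)) ≡ δ c₀ c * deg a (map proj₁ ps)
    monochromatic-star a w₀ c₀ c []             _    = sym (*-zeroʳ (δ c₀ c))
    monochromatic-star a w₀ c₀ c ((y , j) ∷ ps) mono
      rewrite mono (here refl) | monochromatic-star a w₀ c₀ c ps (mono ∘ there)
      = trans (cong (_+ δ c₀ c * deg a (map proj₁ ps)) (trans (b2n-∧ (adj H a y) _) (*-comm _ (δ c₀ c))))
              (sym (*-distribˡ-+ (δ c₀ c) (b2n (adj H a y)) _))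

    extend-single : ∀ {a ws w₀ c₀ W U} → Even (deg a ws) → Embedding ws W → w₀ ∈ U →
      (∀ {w} → w ∈ W → w ∈ U × w₀ ≢ w × χ w₀ w ≡ c₀) → Embedding (a ∷ ws) U
    extend-single {a} {_} {w₀} {c₀} e φ w₀∈U nbrs with graph φ | domain φ | unique φ | image φ | even φ
    ... | ps | refl | uniq | im | ev = record
      { graph  = (a , w₀) ∷ ps
      ; domain = refl
      ; unique = All.tabulate (proj₁ ∘ proj₂ ∘ nbrs ∘ im) ∷ uniq
      ; image  = λ { (here refl) → w₀∈U ; (there w∈) → proj₁ (nbrs (im w∈)) }
      ; even   = λ c → subst Even
          (sym (trans (∑-pairs-∷ (edgeOf c) (a , w₀) ps)
                      (cong (_+ _) (monochromatic-star a w₀ c₀ c ps (proj₂ ∘ proj₂ ∘ nbrs ∘ im)))))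
          (∣m∣n⇒∣m+n (∣n⇒∣m*n (δ c₀ c) e) (ev c))
      }

    -- The two stars share the colour `c₀`, so their counts add up to a multiple of the sum of the
    -- two degrees. Non-adjacency of `a` and `a′` removes the edge between the new vertices, whose
    -- colour is uncontrolled.
    extend-double : ∀ {a a′ ws w₀ w₁ c₀ W U} → adj H a a′ ≡ false → Even (deg a ws + deg a′ ws) →
      Embedding ws W → w₀ ∈ U → w₁ ∈ U → w₀ ≢ w₁ →
      (∀ {w} → w ∈ W → w ∈ U × (w₀ ≢ w × χ w₀ w ≡ c₀) × (w₁ ≢ w × χ w₁ w ≡ c₀)) →
      Embedding (a ∷ a′ ∷ ws) U
    extend-double {a} {a′} {_} {w₀} {w₁} {c₀} a≁a′ e φ w₀∈U w₁∈U w₀≢w₁ nbrs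
      with graph φ | domain φ | unique φ | image φ | even φ
    ... | ps | refl | uniq | im | ev = record
      { graph  = (a , w₀) ∷ (a′ , w₁) ∷ ps
      ; domain = refl
      ; unique = (w₀≢w₁ ∷ All.tabulate (proj₁ ∘ proj₁ ∘ proj₂ ∘ nbrs ∘ im))
                 ∷ All.tabulate (proj₁ ∘ proj₂ ∘ proj₂ ∘ nbrs ∘ im) ∷ uniq
      ; image  = λ { (here refl) → w₀∈U ; (there (here refl)) → w₁∈U
                   ; (there (there w∈)) → proj₁ (nbrs (im w∈)) }
      ; even   = λ c → subst Even (sym (count c)) (∣m∣n⇒∣m+n (∣n⇒∣m*n (δ c₀ c) e) (ev c))
      }
      where
      ws = map proj₁ ps
      count : ∀ c → ∑ (pairs ((a , w₀) ∷ (a′ , w₁) ∷ ps)) (edgeOf c) ≡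
                    δ c₀ c * (deg a ws + deg a′ ws) + ∑ (pairs ps) (edgeOf c)
      count c
        rewrite ∑-pairs-∷ (edgeOf c) (a , w₀) ((a′ , w₁) ∷ ps) | ∑-pairs-∷ (edgeOf c) (a′ , w₁) ps
              | a≁a′
              | monochromatic-star a w₀ c₀ c ps (proj₂ ∘ proj₁ ∘ proj₂ ∘ nbrs ∘ im)
              | monochromatic-star a′ w₁ c₀ c ps (proj₂ ∘ proj₂ ∘ proj₂ ∘ nbrs ∘ im)
        = eq (δ c₀ c) (deg a ws) (deg a′ ws) _
        where
        eq : ∀ d x y z → d * x + (d * y + z) ≡ d * (x + y) + z
        eq = solve-∀

    singleton-embedding : ∀ x u U → Embedding (x ∷ []) (u ∷ U)
    -- No candidate has to be seen in colour `c₀`, as `W` is empty; `zero` is a default.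
    singleton-embedding x u U = extend-single {c₀ = zero} {W = []} (2 ∣0) []-embedding (here refl) λ ()

  -- `K` depends on the peeling and `b` alone and is fixed before n, k and `χ`. Base cases are the
  -- parts with at most one vertex after them: there the truncated exponent `length L ∸ 2` drops by
  -- less than the size of the part, so the general step cannot be afforded.
  embed : ∀ {L} → Peeling L → ∀ b → ∃ λ K → ∀ {n k} (χ : Fin n → Fin n → Fin (suc k)) → K ≤ suc k →
    ∀ {U} → Unique U → suc b * suc k ^ (length L ∸ 2) ≤ b * length U → Embedding χ L U
  embed [] b = 0 , λ χ _ _ _ → []-embedding χ
  embed (single {x} {[]} e P) b = 0 , proof
    where
    proof : ∀ {n k} (χ : Fin n → Fin n → Fin (suc k)) → 0 ≤ suc k → ∀ {U} → Unique U →
            suc b * 1 ≤ b * length U → Embedding χ (x ∷ []) U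
    proof χ _ {U} U! large with U | large⇒2≤ b large
    ... | u ∷ U′ | _ = singleton-embedding χ x u U′
  embed (single {x} {y ∷ []} e P) b = 0 , proof
    where
    proof : ∀ {n k} (χ : Fin n → Fin n → Fin (suc k)) → 0 ≤ suc k → ∀ {U} → Unique U →
            suc b * 1 ≤ b * length U → Embedding χ (x ∷ y ∷ []) U
    proof χ _ {U} U! large with U | U! | large⇒2≤ b large
    ... | u ∷ []     | _                | s≤s ()
    ... | u ∷ u′ ∷ _ | (u≢u′ ∷ _) ∷ _ | _ =
      extend-single χ {c₀ = χ u u′} e (singleton-embedding χ y u′ []) (here refl)
        λ { (here refl) → there (here refl) , u≢u′ , refl }
  embed (single {x} {ws@(y ∷ z ∷ ws′)} e P) b with embed P (suc b)
  ... | K , rec = K ⊔ suc (b * suc b) , proof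
    where
    proof : ∀ {n k} (χ : Fin n → Fin n → Fin (suc k)) → K ⊔ suc (b * suc b) ≤ suc k →
            ∀ {U} → Unique U → suc b * suc k ^ suc (length ws′) ≤ b * length U → Embedding χ (x ∷ ws) U
    proof {k = k} χ K≤k {[]} U! large with () ← large⇒2≤ b {{m^n≢0 (suc k) (suc (length ws′))}} large
    proof {k = k} χ K≤k {u ∷ U} (u≢ ∷ U!) large with majority (χ u) U
    ... | c , bound = extend-single χ e
      (rec χ (m⊔n≤o⇒m≤o K _ K≤k) (filter⁺ (λ w → χ u w Fin.≟ c) U!)
        (single-step-bound b (suc k) (length ws′) (length U) _ (m⊔n≤o⇒n≤o K _ K≤k) large bound))
      (here refl)
      λ w∈ → let w∈U , col = ∈-filter⁻ (λ w → χ u w Fin.≟ c) {xs = U} w∈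
             in there w∈U , All.lookup u≢ w∈U , col
  embed (double {x} {x′} {[]} x≁x′ e P) b = 0 , proof
    where
    proof : ∀ {n k} (χ : Fin n → Fin n → Fin (suc k)) → 0 ≤ suc k → ∀ {U} → Unique U →
            suc b * 1 ≤ b * length U → Embedding χ (x ∷ x′ ∷ []) U
    proof χ _ {U} U! large with U | U! | large⇒2≤ b large
    ... | u ∷ []     | _                | s≤s ()
    ... | u ∷ u′ ∷ _ | (u≢u′ ∷ _) ∷ _ | _ =
      extend-double χ {c₀ = zero} {W = []} x≁x′ e ([]-embedding χ) (here refl) (there (here refl)) u≢u′ λ ()
  -- The exponent 1 pays for one factor k, not two. So `y` goes first, to `u`, and the pair is
  -- chosen inside a majority class towards `u`. The class is taken by `χ w u`, the orientation in
  -- which the stars of the pair are read, since symmetry of `χ` is not assumed here.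
  embed (double {x} {x′} {y ∷ []} x≁x′ e P) b = suc b , proof
    where
    proof : ∀ {n k} (χ : Fin n → Fin n → Fin (suc k)) → suc b ≤ suc k → ∀ {U} → Unique U →
            suc b * suc k ^ 1 ≤ b * length U → Embedding χ (x ∷ x′ ∷ y ∷ []) U
    proof {k = k} χ b<k {[]} U! large with () ← large⇒2≤ b {{m^n≢0 (suc k) 1}} large
    proof {k = k} χ b<k {u ∷ U} (u≢ ∷ U!) large with majority (λ w → χ w u) U
    ... | c , bound
      with filter (λ w → χ w u Fin.≟ c) U in W≡ | cherry-bound b (suc k) (length U) _ b<k large bound
         | filter⁺ (λ w → χ w u Fin.≟ c) U!
         | (λ {w} → ∈-filter⁻ (λ w → χ w u Fin.≟ c) {v = w} {xs = U})
    ... | w₀ ∷ []      | s≤s () | _ | _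
    ... | w₀ ∷ w₁ ∷ _ | _ | (w₀≢w₁ ∷ _) ∷ _ | ∈W with ∈W (here refl) | ∈W (there (here refl))
    ... | w₀∈U , col₀ | w₁∈U , col₁ =
      extend-double χ x≁x′ e (singleton-embedding χ y u []) (there w₀∈U) (there w₁∈U) w₀≢w₁
        λ { (here refl) → here refl , (≢-sym (All.lookup u≢ w₀∈U) , col₀)
                                    , (≢-sym (All.lookup u≢ w₁∈U) , col₁) }
  embed (double {x} {x′} {ws@(y ∷ z ∷ ws′)} x≁x′ e P) b with embed P (suc b)
  ... | K , rec = K ⊔ suc (b * suc b) , proof
    where
    proof : ∀ {n k} (χ : Fin n → Fin n → Fin (suc k)) → K ⊔ suc (b * suc b) ≤ suc k →
            ∀ {U} → Unique U → suc b * suc k ^ suc (suc (length ws′)) ≤ b * length U →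
            Embedding χ (x ∷ x′ ∷ ws) U
    proof {k = k} χ K≤k {U} U! large
      with many-twins Fin._≟_ χ U! (large⇒2≤ b {{m^n≢0 (suc k) (suc (suc (length ws′)))}} large)
    ... | w₀ , w₁ , w₀∈U , w₁∈U , w₀≢w₁ , bound with majority (χ w₀) (filter (twin? Fin._≟_ χ w₀ w₁) U)
    ... | c , bound′ = extend-double χ x≁x′ e
      (rec χ (m⊔n≤o⇒m≤o K _ K≤k)
        (filter⁺ (λ w → χ w₀ w Fin.≟ c) (filter⁺ (twin? Fin._≟_ χ w₀ w₁) U!))
        (double-step-bound b (suc k) (length ws′) (length U) _ _ (m⊔n≤o⇒n≤o K _ K≤k) large bound bound′))
      w₀∈U w₁∈U w₀≢w₁
      λ w∈ → let w∈M , col = ∈-filter⁻ (λ w → χ w₀ w Fin.≟ c) {xs = filter (twin? Fin._≟_ χ w₀ w₁) U} w∈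
                 w∈U , w₀≢w , w₁≢w , col≡ = ∈-filter⁻ (twin? Fin._≟_ χ w₀ w₁) {xs = U} w∈M
             in w∈U , (w₀≢w , col) , (w₁≢w , trans col≡ col)

-- Refining even decompositions

even-or-even-suc : ∀ m → Even m ⊎ Even (suc m)
even-or-even-suc zero    = inj₁ (2 ∣0)
even-or-even-suc (suc m) with even-or-even-suc m
... | inj₁ e = inj₂ (∣m∣n⇒∣m+n (∣-refl {2}) e)
... | inj₂ e = inj₁ e

odd+odd : ∀ m n → ¬ Even m → ¬ Even n → Even (m + n)
odd+odd m n m-odd n-odd with even-or-even-suc m | even-or-even-suc n
... | inj₁ e | _      = ⊥-elim (m-odd e)
... | inj₂ _ | inj₁ e = ⊥-elim (n-odd e)
... | inj₂ e | inj₂ e′ =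
  ∣m+n∣m⇒∣n (subst Even (cong suc (+-suc m n)) (∣m∣n⇒∣m+n e e′)) (∣-refl {2})

lookup-─ : ∀ {n} (S S′ : Subset n) x → lookup (S ─ S′) x ≡ lookup S x ∧ not (lookup S′ x)
lookup-─ (true  ∷ S) (true  ∷ S′) zero    = refl
lookup-─ (true  ∷ S) (false ∷ S′) zero    = refl
lookup-─ (false ∷ S) (true  ∷ S′) zero    = refl
lookup-─ (false ∷ S) (false ∷ S′) zero    = refl
lookup-─ (_     ∷ S) (_     ∷ S′) (suc x) = lookup-─ S S′ x

module _ (H : SimpleGraph) where

  private
    total : List (Fin (v H)) → List (Fin (v H)) → ℕ
    total A L = ∑ A (λ x → deg H x L)

    Independent : List (Fin (v H)) → Set
    Independent A = ∀ {x y} → x ∈ A → y ∈ A → adj H x y ≡ false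

    total-∷ : ∀ {a A} L → (∀ {x} → x ∈ A → adj H x a ≡ false) → total A (a ∷ L) ≡ total A L
    total-∷ {A = A} L ind = ∑-cong-∈ A λ {x} x∈A → cong (λ z → b2n z + deg H x L) (ind x∈A)

  mutual

    -- Vertices of even degree are peeled singly; one of odd degree is held back until a second
    -- turns up. Independence of `A` means that vertices of the part already moved into `L` do not
    -- change the degrees of the others.
    refine-part : ∀ A {L} → Peeling H L → Independent A → Even (total A L) →
      ∃ λ L′ → Peeling H L′ × L′ ↭ A ++ L
    refine-part []      {L} P ind e = L , P , refl
    refine-part (a ∷ A) {L} P ind e with 2 ∣? deg H a L
    ... | no a-odd = refine-part-odd a A P ind e a-odd
    ... | yes a-even with refine-part A (single a-even P) (λ x y → ind (there x) (there y))
                            (subst Even (sym (total-∷ L (λ x → ind (there x) (here refl)))) (∣m+n∣m⇒∣n e a-even))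
    ... | L′ , P′ , L′↭ = L′ , P′ , (L′↭ then shift a A L)

    -- Here `p` is the vertex held back, still waiting for a partner of odd degree.
    refine-part-odd : ∀ p A {L} → Peeling H L → Independent (p ∷ A) → Even (total (p ∷ A) L) →
      ¬ Even (deg H p L) → ∃ λ L′ → Peeling H L′ × L′ ↭ p ∷ A ++ L
    -- A partner must exist: otherwise the odd degree of `p` would be the whole remaining edge
    -- count, which is even.
    refine-part-odd p []      {L} P ind e p-odd =
      ⊥-elim (p-odd (subst Even (+-identityʳ (deg H p L)) e))
    refine-part-odd p (a ∷ A) {L} P ind e p-odd with 2 ∣? deg H a L
    ... | yes a-even with refine-part-odd p A (single a-even P) ind′
            (subst Even (sym (total-∷ {A = p ∷ A} L
              λ { (here refl) → ind (here refl) (there (here refl))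
                ; (there x) → ind (there (there x)) (there (here refl)) }))
              (∣m+n∣m⇒∣n (subst Even (eq (deg H p L) (deg H a L) (total A L)) e) a-even))
            (λ e′ → p-odd (subst (λ z → Even (b2n z + deg H p L)) (ind (here refl) (there (here refl))) e′))
      where
      eq : ∀ x y z → x + (y + z) ≡ y + (x + z)
      eq = solve-∀
      ind′ : Independent (p ∷ A)
      ind′ x y = ind (skip x) (skip y)
        where
        skip : ∀ {x} → x ∈ p ∷ A → x ∈ p ∷ a ∷ A
        skip (here e)  = here e
        skip (there x) = there (there x)
    ... | L′ , P′ , L′↭ = L′ , P′ , (L′↭ then prep p (shift a A L))
    refine-part-odd p (a ∷ A) {L} P ind e p-odd | no a-odd
      with refine-part A (double (ind (here refl) (there (here refl))) p+a-even P)
             (λ x y → ind (there (there x)) (there (there y)))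
             (subst Even (sym (trans (total-∷ (a ∷ L) (λ x → ind (there (there x)) (here refl)))
                                     (total-∷ L (λ x → ind (there (there x)) (there (here refl))))))
               (∣m+n∣m⇒∣n (subst Even (sym (+-assoc (deg H p L) (deg H a L) (total A L))) e) p+a-even))
      where
      p+a-even : Even (deg H p L + deg H a L)
      p+a-even = odd+odd (deg H p L) (deg H a L) p-odd a-odd
    ... | L′ , P′ , L′↭ = L′ , P′ , ((L′↭ then shift p A (a ∷ L)) then prep p (shift a A L))

  members : Subset (v H) → List (Fin (v H))
  members S = filter (T? ∘ lookup S) (allFin (v H))

  members-full : members fullSet ≡ allFin (v H)
  members-full = filter-all (T? ∘ lookup fullSet)
    (All.tabulate λ {x} _ → subst T (sym (lookup-replicate x true)) _)

  members-empty : members emptySet ≡ []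
  members-empty = filter-none (T? ∘ lookup emptySet) {xs = allFin (v H)}
    (All.tabulate λ {x} _ → subst T (lookup-replicate x false))

  members-─ : ∀ {S S′} → S′ ⊆ S → members (S ─ S′) ++ members S′ ↭ members S
  members-─ {S} {S′} S′⊆S = go (allFin (v H))
    where
    go : ∀ xs → filter (T? ∘ lookup (S ─ S′)) xs ++ filter (T? ∘ lookup S′) xs ↭ filter (T? ∘ lookup S) xs
    go []       = refl
    go (x ∷ xs) with lookup S′ x in S′x | lookup S x in Sx | lookup (S ─ S′) x | lookup-─ S S′ x
    ... | true  | true  | _ | refl = shift x (filter (T? ∘ lookup (S ─ S′)) xs) _ then prep x (go xs)
    ... | true  | false | _ | _ with () ← trans (sym Sx) ([]=⇒lookup (S′⊆S (lookup⇒[]= x S′ S′x)))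
    ... | false | true  | _ | refl = prep x (go xs)
    ... | false | false | _ | refl = go xs

  countOrdered-members : ∀ D S → countOrdered (v H) (λ x y → lookup D x ∧ lookup S y ∧ adj H x y) ≡
                         total (members D) (members S)
  countOrdered-members D S = begin
    sumFin (v H) (λ x → sumFin (v H) (λ y → b2n (lookup D x ∧ lookup S y ∧ adj H x y)))
      ≡⟨ sumFin-cong (v H) (λ x → sumFin-∑ (v H) _ id) ⟩
    sumFin (v H) (λ x → ∑ V (λ y → b2n (lookup D x ∧ lookup S y ∧ adj H x y)))
      ≡⟨ sumFin-∑ (v H) _ id ⟩
    ∑ V (λ x → ∑ V (λ y → b2n (lookup D x ∧ lookup S y ∧ adj H x y)))
      ≡⟨ ∑-cong V (λ x → trans
           (∑-cong V λ y → trans (b2n-∧ (lookup D x) _) (cong (b2n (lookup D x) *_) (b2n-∧ (lookup S y) _)))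
           (∑-*ˡ (b2n (lookup D x)) _ V)) ⟩
    ∑ V (λ x → b2n (lookup D x) * ∑ V (λ y → b2n (lookup S y) * b2n (adj H x y)))
      ≡⟨ ∑-cong V (λ x → cong (b2n (lookup D x) *_) (sym (∑-filter _ (T? ∘ lookup S) V))) ⟩
    ∑ V (λ x → b2n (lookup D x) * deg H x (members S))
      ≡⟨ ∑-filter _ (T? ∘ lookup D) V ⟨
    total (members D) (members S) ∎
    where
    open ≡-Reasoning
    V = allFin (v H)

  refine : EvenDecomposition H → ∃ λ L → Peeling H L × L ↭ allFin (v H)
  refine D with go len V end decr indep even
    where
    open EvenDecomposition D
    -- Induction from the empty end of the chain. The tail V₁ ⊃ V₂ ⊃ ... need not start at the full
    -- vertex set, so the recursion runs on the bare data without `start`.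
    go : ∀ len (V : Fin (suc len) → Subset (v H)) → V (fromℕ len) ≡ emptySet →
      (∀ i → V (suc i) ⊆ V (inject₁ i)) →
      (∀ (i : Fin len) x y → lookup (V (inject₁ i) ─ V (suc i)) x ≡ true →
         lookup (V (inject₁ i) ─ V (suc i)) y ≡ true → adj H x y ≡ false) →
      (∀ (i : Fin len) → Even (countOrdered (v H) (λ x y →
         lookup (V (inject₁ i) ─ V (suc i)) x ∧ lookup (V (suc i)) y ∧ adj H x y))) →
      ∃ λ L → Peeling H L × L ↭ members (V zero)
    go zero      V end decr indep even =
      [] , [] , ↭-reflexive (sym (trans (cong members end) members-empty))
    go (suc len) V end decr indep even
      with go len (V ∘ suc) end (decr ∘ suc) (indep ∘ suc) (even ∘ suc)
    ... | L , P , L↭ with refine-part (members Δ) P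
            (λ x∈ y∈ → indep zero _ _ (inΔ x∈) (inΔ y∈))
            (subst Even (trans (countOrdered-members Δ (V (suc zero)))
                               (∑-cong (members Δ) λ x → ∑-↭ _ (↭-sym L↭))) (even zero))
      where
      Δ : Subset (v H)
      Δ = V zero ─ V (suc zero)
      inΔ : ∀ {x} → x ∈ members Δ → lookup Δ x ≡ true
      inΔ x∈ = Equivalence.to T-≡ (proj₂ (∈-filter⁻ (T? ∘ lookup Δ) {xs = allFin (v H)} x∈))
    ... | L′ , P′ , L′↭ = L′ , P′ , ((L′↭ then ++⁺ˡ _ L↭) then members-─ (decr zero))
  ... | L , P , L↭ = L , P , (L↭ then ↭-reflexive (trans (cong members (EvenDecomposition.start D)) members-full))

-- From embeddings to even-chromatic copies

map-≡-tabulate : ∀ {A B : Set} (h : A → B) {m} xs (t : Fin m → B) → map h xs ≡ tabulate t →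
  ∃ λ g → xs ≡ tabulate g × (∀ i → h (g i) ≡ t i)
map-≡-tabulate h {zero}  []       t eq = (λ ()) , refl , λ ()
map-≡-tabulate h {suc m} (x ∷ xs) t eq with map-≡-tabulate h xs (t ∘ suc) (∷-injectiveʳ eq)
... | g , refl , hg = (λ { zero → x ; (suc i) → g i }) , refl , λ { zero → ∷-injectiveˡ eq ; (suc i) → hg i }

tabulate-unique⁻ : ∀ {A : Set} {m} {f : Fin m → A} → Unique (tabulate f) → Injective _≡_ _≡_ f
tabulate-unique⁻ {m = suc m} (f≢ ∷ u) {zero}  {zero}  eq = refl
tabulate-unique⁻ {m = suc m} (f≢ ∷ u) {zero}  {suc j} eq = ⊥-elim (All.lookup f≢ (∈-tabulate⁺ j) eq)
tabulate-unique⁻ {m = suc m} (f≢ ∷ u) {suc i} {zero}  eq = ⊥-elim (All.lookup f≢ (∈-tabulate⁺ i) (sym eq))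
tabulate-unique⁻ {m = suc m} (f≢ ∷ u) {suc i} {suc j} eq = cong suc (tabulate-unique⁻ u eq)

-- Permuting the graph until its first components read `allFin (v H)` turns its second components
-- into the table of `f`. Reordering may swap the ends of an edge, which is where symmetry of `χ`
-- enters.
embedding⇒evenChromatic : ∀ H {n k} (χ : Fin n → Fin n → Fin (suc k)) → SymmetricColouring n (suc k) χ →
  ∀ {L U} → L ↭ allFin (v H) → Embedding H χ L U → AdmitsEvenChromatic H n (suc k) χ
embedding⇒evenChromatic H {n} {k} χ χ-sym L↭ φ
  with ↭-map-inv proj₁ (subst (_↭ allFin (v H)) (sym domain) L↭)
  where open Embedding φ
... | ps , ps≡ , ↭ps with map-≡-tabulate proj₁ ps id (sym ps≡)
... | g , refl , fst-g = f , inj , λ c → subst Even (count c) (even c)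
  where
  open Embedding φ
  f : Fin (v H) → Fin n
  f = proj₂ ∘ g
  inj : Injective _≡_ _≡_ f
  inj = tabulate-unique⁻ (subst Unique (map-tabulate g proj₂)
          (Permutationₛ.Unique-resp-↭ (setoid _) (↭⇒↭ₛ (map⁺ proj₂ ↭ps)) unique))
  count : ∀ c → ∑ (pairs graph) (edgeOf H χ c) ≡
          countUnordered (v H) (λ u w → adj H u w ∧ does (χ (f u) (f w) Fin.≟ c))
  count c = begin
    ∑ (pairs graph) (edgeOf H χ c)
      ≡⟨ ∑-pairs-↭ (edgeOf H χ c) (λ (x , i) (y , j) →
           cong₂ (λ p q → b2n (p ∧ does (q Fin.≟ c))) (adj-sym H x y) (χ-sym i j)) ↭ps ⟩
    ∑ (pairs (tabulate g)) (edgeOf H χ c)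
      ≡⟨ cong (λ xs → ∑ (pairs xs) (edgeOf H χ c)) (map-tabulate id g) ⟨
    ∑ (pairs (map g (allFin (v H)))) (edgeOf H χ c)
      ≡⟨ cong (λ xs → ∑ xs (edgeOf H χ c)) (pairs-map g (allFin (v H))) ⟩
    ∑ (map (λ (x , y) → g x , g y) (pairs (allFin (v H)))) (edgeOf H χ c)
      ≡⟨ ∑-map (edgeOf H χ c) _ (pairs (allFin (v H))) ⟩
    ∑ (pairs (allFin (v H))) (λ (x , y) → edgeOf H χ c (g x , g y))
      ≡⟨ ∑-cong (pairs (allFin (v H))) (λ (x , y) →
           cong₂ (λ p q → b2n (adj H p q ∧ does (χ (f x) (f y) Fin.≟ c))) (fst-g x) (fst-g y)) ⟩
    ∑ (pairs (allFin (v H))) (λ (u , w) → b2n (adj H u w ∧ does (χ (f u) (f w) Fin.≟ c)))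
      ≡⟨ countUnordered-pairs (v H) _ ⟨
    countUnordered (v H) (λ u w → adj H u w ∧ does (χ (f u) (f w) Fin.≟ c)) ∎
    where open ≡-Reasoning

-- Graphs modulo a subspace

odd : ℕ → Bool
odd zero    = false
odd (suc n) = not (odd n)

odd-+ : ∀ m n → odd (m + n) ≡ odd m xor odd n
odd-+ zero    n = refl
odd-+ (suc m) n rewrite odd-+ m n = not-xor (odd m) (odd n)
  where
  not-xor : ∀ a b → not (a xor b) ≡ not a xor b
  not-xor true  true  = refl
  not-xor true  false = refl
  not-xor false b     = refl

odd-b2n : ∀ b → odd (b2n b) ≡ b
odd-b2n true  = refl
odd-b2n false = refl

even⇒¬odd : ∀ {m} → Even m → odd m ≡ false
even⇒¬odd (divides q refl) = go q
  where
  go : ∀ q → odd (q * 2) ≡ false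
  go zero    = refl
  go (suc q) rewrite go q = refl

module _ {A : Set} where

  odd-∑-cong : ∀ {f g : A → ℕ} xs → (∀ x → odd (f x) ≡ odd (g x)) → odd (∑ xs f) ≡ odd (∑ xs g)
  odd-∑-cong []       e = refl
  odd-∑-cong {f} {g} (x ∷ xs) e = trans (odd-+ (f x) (∑ xs f))
    (trans (cong₂ _xor_ (e x) (odd-∑-cong xs e)) (sym (odd-+ (g x) (∑ xs g))))

  odd-∑-witness : ∀ (f : A → ℕ) xs → odd (∑ xs f) ≡ true → ∃ λ x → odd (f x) ≡ true
  odd-∑-witness f (x ∷ xs) o with odd (f x) in fx | trans (sym (odd-+ (f x) (∑ xs f))) o
  ... | true  | _  = x , fx
  ... | false | o′ = odd-∑-witness f xs o′

module _ {n : ℕ} where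

  entry-⊕ : ∀ (G G′ : Mat n) i j → entry (G ⊕ G′) i j ≡ entry G i j xor entry G′ i j
  entry-⊕ G G′ i j = trans (cong (λ r → lookup r j) (lookup-zipWith _ i G G′))
                           (lookup-zipWith _xor_ j (lookup G i) (lookup G′ i))

  entry-zeroGraph : ∀ i j → entry (zeroGraph n) i j ≡ false
  entry-zeroGraph i j = trans (cong (λ r → lookup r j) (lookup-replicate i (Vec.replicate n false)))
                              (lookup-replicate j false)

  lookup-ext : ∀ {A : Set} {m} {xs ys : Vec A m} → (∀ i → lookup xs i ≡ lookup ys i) → xs ≡ ys
  lookup-ext {xs = xs} {ys} e =
    trans (sym (tabulate∘lookup xs)) (trans (tabulate-cong e) (tabulate∘lookup ys))

  entry-ext : ∀ {G G′ : Mat n} → (∀ i j → entry G i j ≡ entry G′ i j) → G ≡ G′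
  entry-ext e = lookup-ext λ i → lookup-ext (e i)

  ⊕-self : ∀ (G : Mat n) → G ⊕ G ≡ zeroGraph n
  ⊕-self G = entry-ext λ i j →
    trans (entry-⊕ G G i j) (trans (xor-same (entry G i j)) (sym (entry-zeroGraph i j)))

  -- Shows that translates with a common element have congruent representatives.
  ⊕-exchange : ∀ (A B C D : Mat n) → A ⊕ B ≡ C ⊕ D → A ⊕ C ≡ B ⊕ D
  ⊕-exchange A B C D eq = entry-ext λ i j → trans (entry-⊕ A C i j) (trans
    (xor-exchange (entry A i j) _ _ _
      (trans (sym (entry-⊕ A B i j)) (trans (cong (λ G → entry G i j) eq) (entry-⊕ C D i j))))
    (sym (entry-⊕ B D i j)))
    where
    xor-exchange : ∀ a b c d → a xor b ≡ c xor d → a xor c ≡ b xor d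
    xor-exchange false false false d     eq = eq
    xor-exchange false false true  false ()
    xor-exchange false false true  true  eq = refl
    xor-exchange false true  false false ()
    xor-exchange false true  false true  eq = refl
    xor-exchange false true  true  false eq = refl
    xor-exchange true  false false false ()
    xor-exchange true  false false true  eq = refl
    xor-exchange true  false true  false eq = refl
    xor-exchange true  true  false false eq = refl
    xor-exchange true  true  true  true  eq = refl

  ⊕-cancelˡ : ∀ (R : Mat n) {G G′} → R ⊕ G ≡ R ⊕ G′ → G ≡ G′
  ⊕-cancelˡ R {G} {G′} eq = entry-ext λ i j → xor-cancelˡ (entry R i j)
    (trans (sym (entry-⊕ R G i j)) (trans (cong (λ M → entry M i j) eq) (entry-⊕ R G′ i j)))
    where
    xor-cancelˡ : ∀ r {g g′} → r xor g ≡ r xor g′ → g ≡ g′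
    xor-cancelˡ false         eq = eq
    xor-cancelˡ true  {false} {false} eq = refl
    xor-cancelˡ true  {true}  {true}  eq = refl

  zeroGraph-isGraph : IsGraphOn n (zeroGraph n)
  zeroGraph-isGraph = (λ i j → trans (entry-zeroGraph i j) (sym (entry-zeroGraph j i))) ,
                      (λ i → entry-zeroGraph i i)

  ⊕-isGraph : ∀ {G G′} → IsGraphOn n G → IsGraphOn n G′ → IsGraphOn n (G ⊕ G′)
  ⊕-isGraph {G} {G′} (s , d) (s′ , d′) =
    (λ i j → trans (entry-⊕ G G′ i j) (trans (cong₂ _xor_ (s i j) (s′ i j)) (sym (entry-⊕ G G′ j i)))) ,
    (λ i → trans (entry-⊕ G G′ i i) (cong₂ _xor_ (d i) (d′ i)))

  -- The zero graph if i ≡ j.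
  edge : Fin n → Fin n → Mat n
  edge i j = Vec.tabulate λ x → Vec.tabulate λ y →
    (does (x Fin.≟ i) ∧ does (y Fin.≟ j)) xor (does (x Fin.≟ j) ∧ does (y Fin.≟ i))

  entry-edge : ∀ i j x y → entry (edge i j) x y ≡
    (does (x Fin.≟ i) ∧ does (y Fin.≟ j)) xor (does (x Fin.≟ j) ∧ does (y Fin.≟ i))
  entry-edge i j x y = trans (cong (λ r → lookup r y) (lookup∘tabulate _ x)) (lookup∘tabulate _ y)

  edge-sym : ∀ i j → edge i j ≡ edge j i
  edge-sym i j = entry-ext λ x y →
    trans (entry-edge i j x y) (trans (xor-comm (does (x Fin.≟ i) ∧ does (y Fin.≟ j)) _) (sym (entry-edge j i x y)))

  edge-isGraph : ∀ i j → IsGraphOn n (edge i j)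
  edge-isGraph i j =
    (λ x y → trans (entry-edge i j x y) (trans
      (trans (xor-comm (does (x Fin.≟ i) ∧ does (y Fin.≟ j)) _)
             (cong₂ _xor_ (∧-comm (does (x Fin.≟ j)) _) (∧-comm (does (x Fin.≟ i)) _)))
      (sym (entry-edge i j y x)))) ,
    (λ x → trans (entry-edge i j x x) (trans
      (cong (_xor (does (x Fin.≟ j) ∧ does (x Fin.≟ i))) (∧-comm (does (x Fin.≟ i)) _))
      (xor-same (does (x Fin.≟ j) ∧ does (x Fin.≟ i)))))

  ⨁ : ∀ {A : Set} → List A → (A → Mat n) → Mat n
  ⨁ []       M = zeroGraph n
  ⨁ (x ∷ xs) M = M x ⊕ ⨁ xs M

  entry-⨁ : ∀ {A : Set} (M : A → Mat n) xs i j →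
            entry (⨁ xs M) i j ≡ odd (∑ xs (λ x → b2n (entry (M x) i j)))
  entry-⨁ M []       i j = entry-zeroGraph i j
  entry-⨁ M (x ∷ xs) i j = begin
    entry (M x ⊕ ⨁ xs M) i j                   ≡⟨ entry-⊕ (M x) (⨁ xs M) i j ⟩
    entry (M x) i j xor entry (⨁ xs M) i j     ≡⟨ cong₂ _xor_ (sym (odd-b2n (entry (M x) i j))) (entry-⨁ M xs i j) ⟩
    odd (b2n (entry (M x) i j)) xor odd (∑ xs (λ x → b2n (entry (M x) i j)))
                                               ≡⟨ odd-+ (b2n (entry (M x) i j)) _ ⟨
    odd (∑ (x ∷ xs) (λ x → b2n (entry (M x) i j))) ∎
    where open ≡-Reasoning

-- Counting graphs

triangle : ℕ → ℕ
triangle zero    = 0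
triangle (suc n) = n + triangle n

triangle≡edgesKn : ∀ n → triangle n ≡ edgesKn n
triangle≡edgesKn zero    = refl
triangle≡edgesKn (suc n) = trans (cong₂ _+_ (sym (nC1≡n n)) (triangle≡edgesKn n)) (nCk+nC[k+1]≡[n+1]C[k+1] n 1)

-- The entries above the diagonal, row by row: the C(n,2) bits that determine a graph.
upper : ∀ {n} → Mat n → Vec Bool (triangle n)
upper []                   = []
upper ((_ ∷ row) ∷ rows) = row Vec.++ upper (Vec.map Vec.tail rows)

upper-injective : ∀ {n} (G G′ : Mat n) → IsGraphOn n G → IsGraphOn n G′ → upper G ≡ upper G′ →
                  ∀ i j → entry G i j ≡ entry G′ i j
upper-injective {suc n} G@((b ∷ row) ∷ rows) G′@((b′ ∷ row′) ∷ rows′) (s , d) (s′ , d′) eq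
  with ++-injective row row′ eq
... | refl , eq′ = λ where
    zero    zero    → trans (d zero) (sym (d′ zero))
    zero    (suc j) → refl
    (suc i) zero    → trans (s (suc i) zero) (s′ zero (suc i))
    (suc i) (suc j) → trans (minor rows i j) (trans (rec i j) (sym (minor rows′ i j)))
  where
  minor : ∀ {m} (rows : Vec (Vec Bool (suc n)) m) i j →
          lookup (lookup rows i) (suc j) ≡ lookup (lookup (Vec.map Vec.tail rows) i) j
  minor rows i j with lookup rows i | lookup-map i Vec.tail rows
  ... | _ ∷ _ | eq = cong (λ r → lookup r j) (sym eq)
  minor-isGraph : ∀ (rows : Vec (Vec Bool (suc n)) n) →
    (∀ i j → lookup (lookup rows i) (suc j) ≡ lookup (lookup rows j) (suc i)) →
    (∀ i → lookup (lookup rows i) (suc i) ≡ false) → IsGraphOn n (Vec.map Vec.tail rows)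
  minor-isGraph rows s d =
    (λ i j → trans (sym (minor rows i j)) (trans (s i j) (minor rows j i))) ,
    (λ i → trans (sym (minor rows i i)) (d i))
  rec = upper-injective (Vec.map Vec.tail rows) (Vec.map Vec.tail rows′)
          (minor-isGraph rows (λ i j → s (suc i) (suc j)) (d ∘ suc))
          (minor-isGraph rows′ (λ i j → s′ (suc i) (suc j)) (d′ ∘ suc)) eq′

bit : Bool → Fin 2
bit false = zero
bit true  = suc zero

bits : ∀ {m} → Vec Bool m → Fin (2 ^ m)
bits []       = zero
bits (b ∷ bs) = combine (bit b) (bits bs)

bits-injective : ∀ {m} (bs bs′ : Vec Bool m) → bits bs ≡ bits bs′ → bs ≡ bs′
bits-injective []       []         eq = refl
bits-injective (b ∷ bs) (b′ ∷ bs′) eq with combine-injective (bit b) (bits bs) (bit b′) (bits bs′) eq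
... | eq₁ , eq₂ = cong₂ _∷_ (bit-injective b b′ eq₁) (bits-injective bs bs′ eq₂)
  where
  bit-injective : ∀ b b′ → bit b ≡ bit b′ → b ≡ b′
  bit-injective false false eq = refl
  bit-injective true  true  eq = refl

unique-graphs-length : ∀ {n} (Gs : List (Mat n)) → Unique Gs → (∀ {G} → G ∈ Gs → IsGraphOn n G) →
                       length Gs ≤ 2 ^ edgesKn n
unique-graphs-length {n} Gs Gs! graph = subst (λ m → length Gs ≤ 2 ^ m) (triangle≡edgesKn n)
  (injective⇒≤ {f = λ i → bits (upper (List.lookup Gs i))} λ {i} {j} eq →
    tabulate-unique⁻ (subst Unique (sym (tabulate-lookup Gs)) Gs!)
      (entry-ext (upper-injective (List.lookup Gs i) (List.lookup Gs j)
        (graph (∈-lookup {xs = Gs} i)) (graph (∈-lookup {xs = Gs} j))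
        (bits-injective (upper (List.lookup Gs i)) (upper (List.lookup Gs j)) eq))))

does-injective : ∀ {m n} {f : Fin m → Fin n} → Injective _≡_ _≡_ f →
                 ∀ p u → does (f p Fin.≟ f u) ≡ does (p Fin.≟ u)
does-injective {f = f} f-inj p u with f p Fin.≟ f u | p Fin.≟ u
... | yes _   | yes _   = refl
... | no _    | no _    = refl
... | yes eq  | no p≢u  = ⊥-elim (p≢u (f-inj eq))
... | no fp≢  | yes p≡u = ⊥-elim (fp≢ (cong f p≡u))

-- Colouring edges by cosets

module _ {n : ℕ} (𝒞 : Subspace n) where

  private
    _∈?_ : ∀ (G : Mat n) Gs → Dec (G ∈ Gs)
    _∈?_ = DecMembership._∈?_ (≡-dec (≡-dec Bool._≟_))

    near? : ∀ G → Decidable (λ R → (G ⊕ R) ∈ elems 𝒞)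
    near? G R = (G ⊕ R) ∈? elems 𝒞

  Covered : List (Mat n) → Mat n → Set
  Covered Rs G = Any (λ R → (G ⊕ R) ∈ elems 𝒞) Rs

  Separated : List (Mat n) → Set
  Separated = AllPairs (λ R R′ → (R ⊕ R′) ∉ elems 𝒞)

  -- Greedy choice: a graph is kept only if it is congruent modulo `𝒞` to none kept so far. Only
  -- cosets met by the given list are represented, so no basis or quotient space has to be built.
  representatives : ∀ Gs → All (IsGraphOn n) Gs →
    ∃ λ Rs → All (IsGraphOn n) Rs × Separated Rs × All (Covered Rs) Gs
  representatives []       []       = [] , [] , [] , []
  representatives (G ∷ Gs) (g ∷ gs) with representatives Gs gs
  ... | Rs , graphs , sep , cov with any? (near? G) Rs
  ... | yes c = Rs , graphs , sep , c ∷ cov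
  ... | no ¬c = G ∷ Rs , g ∷ graphs , All.tabulate (λ R∈ near → ¬c (lose R∈ near)) ∷ sep ,
    here (subst (_∈ elems 𝒞) (sym (⊕-self G)) (hasZero 𝒞)) ∷ All.map there cov

  -- If R ⊕ E = R′ ⊕ E′ with E and E′ in `𝒞`, then R ⊕ R′ = E ⊕ E′ lies in `𝒞`, against separation.
  -- Inside one translate, cancelling R suffices.
  translates-unique : ∀ {Rs} → Separated Rs → Unique (cartesianProductWith _⊕_ Rs (elems 𝒞))
  translates-unique []                 = []
  translates-unique {R ∷ Rs} (sep ∷ seps) =
    Unique.++⁺ (Unique.map⁺ (⊕-cancelˡ R) (distinct 𝒞)) (translates-unique seps) disjoint
    where
    disjoint : ∀ {G} → ¬ (G ∈ map (R ⊕_) (elems 𝒞) × G ∈ cartesianProductWith _⊕_ Rs (elems 𝒞))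
    disjoint (G∈ , G∈′) with ∈-map⁻ (R ⊕_) G∈ | ∈-cartesianProductWith⁻ _⊕_ Rs (elems 𝒞) G∈′
    ... | E , E∈ , refl | R′ , E′ , R′∈ , E′∈ , eq =
      All.lookup sep R′∈ (subst (_∈ elems 𝒞) (sym (⊕-exchange R E R′ E′ eq)) (closed 𝒞 E∈ E′∈))

  separated-length : ∀ Rs → All (IsGraphOn n) Rs → Separated Rs → length Rs * ∣ 𝒞 ∣ ≤ 2 ^ edgesKn n
  separated-length Rs graphsRs sep = subst (_≤ 2 ^ edgesKn n) (count Rs)
    (unique-graphs-length _ (translates-unique sep) isGraph)
    where
    count : ∀ Rs → length (cartesianProductWith _⊕_ Rs (elems 𝒞)) ≡ length Rs * ∣ 𝒞 ∣
    count []       = refl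
    count (R ∷ Rs) = trans (length-++ (map (R ⊕_) (elems 𝒞)))
                           (cong₂ _+_ (length-map (R ⊕_) (elems 𝒞)) (count Rs))
    isGraph : ∀ {G} → G ∈ cartesianProductWith _⊕_ Rs (elems 𝒞) → IsGraphOn n G
    isGraph G∈ with ∈-cartesianProductWith⁻ _⊕_ Rs (elems 𝒞) G∈
    ... | R , E , R∈ , E∈ , refl = ⊕-isGraph {G = R} {E} (All.lookup graphsRs R∈) (All.lookup (graphs 𝒞) E∈)

  ⨁-closed : ∀ {A : Set} {M : A → Mat n} xs → (∀ x → M x ∈ elems 𝒞) → ⨁ xs M ∈ elems 𝒞
  ⨁-closed []       M∈ = hasZero 𝒞
  ⨁-closed (x ∷ xs) M∈ = closed 𝒞 (M∈ x) (⨁-closed xs M∈)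

  module _ (H : SimpleGraph) (f : Fin (v H) → Fin n) (f-inj : Injective _≡_ _≡_ f) where

    private
      V = allFin (v H)

    edgeImage : Fin (v H) × Fin (v H) → Mat n
    edgeImage (u , w) = if adj H u w then edge (f u) (f w) else zeroGraph n

    entry-edgeImage : ∀ u w x y → entry (edgeImage (u , w)) x y ≡ adj H u w ∧
      ((does (x Fin.≟ f u) ∧ does (y Fin.≟ f w)) xor (does (x Fin.≟ f w) ∧ does (y Fin.≟ f u)))
    entry-edgeImage u w x y with adj H u w
    ... | true  = entry-edge (f u) (f w) x y
    ... | false = entry-zeroGraph x y

    -- Built as a sum of single edges, so that it can be compared term by term with the sum of the
    -- edges' representatives.
    copy : Mat n
    copy = ⨁ (pairs V) edgeImage

    entry-copy : ∀ p q → entry copy (f p) (f q) ≡ adj H p q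
    entry-copy p q = begin
      entry copy (f p) (f q)
        ≡⟨ entry-⨁ edgeImage (pairs V) (f p) (f q) ⟩
      odd (∑ (pairs V) (λ e → b2n (entry (edgeImage e) (f p) (f q))))
        ≡⟨ odd-∑-cong (pairs V) (λ (u , w) → pointwise u w) ⟩
      odd (∑ (pairs V) (λ (u , w) → g u w + g w u))
        ≡⟨ cong odd (+-identityʳ (∑ (pairs V) (λ (u , w) → g u w + g w u))) ⟨
      odd (∑ (pairs V) (λ (u , w) → g u w + g w u) + 0)
        -- The added diagonal terms vanish because H has no loops; they complete the sum over pairs
        -- to a double sum.
        ≡⟨ cong (λ z → odd (∑ (pairs V) (λ (u , w) → g u w + g w u) + z))
             (trans (∑-cong V g-diagonal) (∑-0 V)) ⟨
      odd (∑ (pairs V) (λ (u , w) → g u w + g w u) + ∑ V (λ u → g u u))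
        ≡⟨ cong odd (∑-pairs-handshake g V) ⟨
      odd (∑ V (λ u → ∑ V (g u)))
        ≡⟨ cong odd (∑-cong V λ u → ∑-*ˡ (δ p u) _ V) ⟩
      odd (∑ V (λ u → δ p u * ∑ V (λ w → δ q w * b2n (adj H u w))))
        ≡⟨ cong odd (∑-δ-allFin p _) ⟩
      odd (∑ V (λ w → δ q w * b2n (adj H p w)))
        ≡⟨ cong odd (∑-δ-allFin q _) ⟩
      odd (b2n (adj H p q))
        ≡⟨ odd-b2n (adj H p q) ⟩
      adj H p q ∎
      where
      open ≡-Reasoning
      g : Fin (v H) → Fin (v H) → ℕ
      g u w = δ p u * (δ q w * b2n (adj H u w))
      g-diagonal : ∀ u → g u u ≡ 0
      g-diagonal u rewrite adj-irr H u | *-zeroʳ (δ q u) = *-zeroʳ (δ p u)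
      bool : ∀ a b c d e → odd (b2n (e ∧ ((a ∧ b) xor (c ∧ d)))) ≡
                           odd (b2n a * (b2n b * b2n e) + b2n c * (b2n d * b2n e))
      bool a b c d false = trans (sym (even⇒¬odd (2 ∣0))) (cong odd (sym (cong₂ _+_ (zeros a b) (zeros c d))))
        where
        zeros : ∀ a b → b2n a * (b2n b * 0) ≡ 0
        zeros a b = trans (cong (b2n a *_) (*-zeroʳ (b2n b))) (*-zeroʳ (b2n a))
      bool true  true  true  true  true = refl
      bool true  true  true  false true = refl
      bool true  true  false d     true = refl
      bool true  false true  true  true = refl
      bool true  false true  false true = refl
      bool true  false false d     true = refl
      bool false b     true  true  true = refl
      bool false b     true  false true = refl
      bool false b     false d     true = refl
      pointwise : ∀ u w → odd (b2n (entry (edgeImage (u , w)) (f p) (f q))) ≡ odd (g u w + g w u)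
      pointwise u w rewrite entry-edgeImage u w (f p) (f q)
        | does-injective f-inj p u | does-injective f-inj q w
        | does-injective f-inj p w | does-injective f-inj q u
        | adj-sym H w u
        = bool (does (p Fin.≟ u)) (does (q Fin.≟ w)) (does (p Fin.≟ w)) (does (q Fin.≟ u)) (adj H u w)

    copy-support : ∀ x y → entry copy x y ≡ true → ∃ (λ u → f u ≡ x) × ∃ (λ u → f u ≡ y)
    copy-support x y xy with odd-∑-witness _ (pairs V) (trans (sym (entry-⨁ edgeImage (pairs V) x y)) xy)
    ... | (u , w) , o = endpoints u w (trans (sym (entry-edgeImage u w x y)) (trans (sym (odd-b2n _)) o))
      where
      endpoints : ∀ u w → adj H u w ∧
        ((does (x Fin.≟ f u) ∧ does (y Fin.≟ f w)) xor (does (x Fin.≟ f w) ∧ does (y Fin.≟ f u))) ≡ true →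
        ∃ (λ u → f u ≡ x) × ∃ (λ u → f u ≡ y)
      endpoints u w e with adj H u w | x Fin.≟ f u | y Fin.≟ f w | x Fin.≟ f w | y Fin.≟ f u
      ... | true  | yes x≡ | yes y≡ | _      | _      = (u , sym x≡) , (w , sym y≡)
      ... | true  | yes _  | no _   | yes x≡ | yes y≡ = (w , sym x≡) , (u , sym y≡)
      ... | true  | no _   | _      | yes x≡ | yes y≡ = (w , sym x≡) , (u , sym y≡)
      ... | true  | yes _  | no _   | yes _  | no _   with () ← e
      ... | true  | yes _  | no _   | no _   | _      with () ← e
      ... | true  | no _   | _      | yes _  | no _   with () ← e
      ... | true  | no _   | _      | no _   | _      with () ← e
      ... | false | _      | _      | _      | _      with () ← e

    copy-isCopy : IsCopy H n copy
    copy-isCopy = f , f-inj , entry-copy , copy-support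

    -- Modulo 𝒞, the copy is the sum of its edges' representatives, which cancel in pairs.
    evenChromatic⇒copy∈ : ∀ {k} (χ : Fin n → Fin n → Fin k) (R : Fin k → Mat n) →
      (∀ i j → (edge i j ⊕ R (χ i j)) ∈ elems 𝒞) → IsEvenChromaticCopy H n k χ f → copy ∈ elems 𝒞
    evenChromatic⇒copy∈ {k} χ R near (_ , even) =
      subst (_∈ elems 𝒞) same (⨁-closed {M = λ e → edgeImage e ⊕ rep e} (pairs V) λ (u , w) → near′ u w)
      where
      open ≡-Reasoning
      rep : Fin (v H) × Fin (v H) → Mat n
      rep (u , w) = if adj H u w then R (χ (f u) (f w)) else zeroGraph n
      near′ : ∀ u w → (edgeImage (u , w) ⊕ rep (u , w)) ∈ elems 𝒞
      near′ u w with adj H u w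
      ... | true  = near (f u) (f w)
      ... | false = closed 𝒞 (hasZero 𝒞) (hasZero 𝒞)
      module _ (x y : Fin n) where
        h : Fin k → ℕ
        h c = b2n (entry (R c) x y)
        count : Fin k → ℕ
        count c = ∑ (pairs V) (λ (u , w) → b2n (adj H u w ∧ does (χ (f u) (f w) Fin.≟ c)))
        entry-rep : ∀ u w → b2n (entry (rep (u , w)) x y) ≡
          ∑ (allFin k) (λ c → h c * b2n (adj H u w ∧ does (χ (f u) (f w) Fin.≟ c)))
        entry-rep u w with adj H u w
        ... | true  = trans (sym (∑-δ-allFin (χ (f u) (f w)) h)) (∑-cong (allFin k) λ c → *-comm _ (h c))
        ... | false = trans (cong b2n (entry-zeroGraph x y))
                            (sym (trans (∑-cong (allFin k) λ c → *-zeroʳ (h c)) (∑-0 (allFin k))))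
        reps-even : Even (∑ (pairs V) (λ e → b2n (entry (rep e) x y)))
        reps-even = subst Even (sym (begin
          ∑ (pairs V) (λ e → b2n (entry (rep e) x y))
            ≡⟨ ∑-cong (pairs V) (λ (u , w) → entry-rep u w) ⟩
          ∑ (pairs V) (λ (u , w) → ∑ (allFin k) (λ c → h c * b2n (adj H u w ∧ does (χ (f u) (f w) Fin.≟ c))))
            ≡⟨ ∑-swap _ (pairs V) (allFin k) ⟩
          ∑ (allFin k) (λ c → ∑ (pairs V) (λ (u , w) → h c * b2n (adj H u w ∧ does (χ (f u) (f w) Fin.≟ c))))
            ≡⟨ ∑-cong (allFin k) (λ c → ∑-*ˡ (h c) _ (pairs V)) ⟩
          ∑ (allFin k) (λ c → h c * count c) ∎))
          (∑-even (allFin k) λ c → ∣n⇒∣m*n (h c) (subst Even (countUnordered-pairs (v H) _) (even c)))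
      same : ⨁ (pairs V) (λ e → edgeImage e ⊕ rep e) ≡ copy
      same = entry-ext λ x y → begin
        entry (⨁ (pairs V) (λ e → edgeImage e ⊕ rep e)) x y
          ≡⟨ entry-⨁ _ (pairs V) x y ⟩
        odd (∑ (pairs V) (λ e → b2n (entry (edgeImage e ⊕ rep e) x y)))
          ≡⟨ odd-∑-cong (pairs V) (λ e → trans (trans (odd-b2n _) (entry-⊕ (edgeImage e) (rep e) x y))
               (trans (sym (cong₂ _xor_ (odd-b2n (entry (edgeImage e) x y)) (odd-b2n (entry (rep e) x y))))
                      (sym (odd-+ (b2n (entry (edgeImage e) x y)) _)))) ⟩
        odd (∑ (pairs V) (λ e → b2n (entry (edgeImage e) x y) + b2n (entry (rep e) x y)))
          ≡⟨ cong odd (∑-+ _ _ (pairs V)) ⟩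
        odd (∑ (pairs V) (λ e → b2n (entry (edgeImage e) x y)) + ∑ (pairs V) (λ e → b2n (entry (rep e) x y)))
          ≡⟨ odd-+ (∑ (pairs V) (λ e → b2n (entry (edgeImage e) x y))) _ ⟩
        odd (∑ (pairs V) (λ e → b2n (entry (edgeImage e) x y))) xor odd (∑ (pairs V) (λ e → b2n (entry (rep e) x y)))
          ≡⟨ cong₂ _xor_ (sym (entry-⨁ edgeImage (pairs V) x y)) (even⇒¬odd (reps-even x y)) ⟩
        entry copy x y xor false
          ≡⟨ xor-comm (entry copy x y) false ⟩
        entry copy x y ∎

  -- The last component says that the density of `𝒞` is at most 1/k, which lets a lower bound on the
  -- number of colours pass to an upper bound on the density.
  coset-colouring : ∀ H → CopyFree H n 𝒞 → ∃₂ λ k (χ : Fin n → Fin n → Fin k) →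
    SymmetricColouring n k χ × ¬ AdmitsEvenChromatic H n k χ × k * ∣ 𝒞 ∣ ≤ 2 ^ edgesKn n
  coset-colouring H free
    -- Listing the zero graph guarantees a representative, the default colour in `coset`.
    with representatives (zeroGraph n ∷ edges) (zeroGraph-isGraph ∷ All.tabulate edges-graphs)
    where
    edges = cartesianProductWith edge (allFin n) (allFin n)
    edges-graphs : ∀ {G} → G ∈ edges → IsGraphOn n G
    edges-graphs G∈ with ∈-cartesianProductWith⁻ edge (allFin n) (allFin n) G∈
    ... | i , j , _ , _ , refl = edge-isGraph i j
  ... | Rs , graphsRs , sep , zero-covered ∷ cov =
    length Rs , (λ i j → coset (edge i j)) , (λ i j → cong coset (edge-sym i j)) ,
    (λ (f , f-inj , even) → free _
      (evenChromatic⇒copy∈ H f f-inj (λ i j → coset (edge i j)) (List.lookup Rs)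
        (λ i j → coset-near (All.lookup cov (∈-cartesianProductWith⁺ edge (∈-allFin i) (∈-allFin j))))
        (f-inj , even))
      (copy-isCopy H f f-inj)) ,
    separated-length Rs graphsRs sep
    where
    -- The colour is computed from the graph alone, not from a proof that it is covered; hence
    -- `edge-sym` makes the colouring symmetric.
    coset : Mat n → Fin (length Rs)
    coset G with any? (near? G) Rs
    ... | yes c = index c
    ... | no _  = index zero-covered
    coset-near : ∀ {G} → Covered Rs G → (G ⊕ List.lookup Rs (coset G)) ∈ elems 𝒞
    coset-near {G} c with any? (near? G) Rs
    ... | yes c′ = lookup-index c′
    ... | no ¬c  = ⊥-elim (¬c c)

-- Bounds on the number of colours

-- An injective renaming of colours leaves every colour class as it was.
merge-colours : ∀ H {n k k′} (χ : Fin n → Fin n → Fin k) (k≤k′ : k ≤ k′) →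
  AdmitsEvenChromatic H n k′ (λ i j → inject≤ (χ i j) k≤k′) → AdmitsEvenChromatic H n k χ
merge-colours H χ k≤k′ (f , f-inj , even) = f , f-inj , λ c → subst Even
  (sumFin-cong (v H) λ u → sumFin-cong (v H) λ w → cong (λ d → b2n ((Fin.toℕ u <ᵇ Fin.toℕ w) ∧ adj H u w ∧ d))
    (does-injective (inject≤-injective k≤k′ k≤k′ _ _) (χ (f u) (f w)) c))
  (even (inject≤ c k≤k′))

^-distribʳ-* : ∀ x y m → (x * y) ^ m ≡ x ^ m * y ^ m
^-distribʳ-* x y zero    = refl
^-distribʳ-* x y (suc m) rewrite ^-distribʳ-* x y m = eq x y (x ^ m) (y ^ m)
  where
  eq : ∀ x y p q → x * y * (p * q) ≡ x * p * (y * q)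
  eq = solve-∀

module _ (H : SimpleGraph) (D : EvenDecomposition H) where

  private
    m = v H ∸ 2

  -- A palette with fewer than K + 1 colours is padded with unused ones.
  forced-copy : ∀ b → ∃ λ K → ∀ {n k} (χ : Fin n → Fin n → Fin (suc k)) → SymmetricColouring n (suc k) χ →
    suc b * suc (k ⊔ K) ^ m ≤ b * n → AdmitsEvenChromatic H n (suc k) χ
  forced-copy b with refine H D
  ... | L , P , L↭ with embed H P b
  ... | K , emb = K , λ {n} {k} χ χ-sym large →
    let k≤ = s≤s (m≤m⊔n k K)
        χ′ = λ i j → inject≤ (χ i j) k≤
    in merge-colours H χ k≤ (embedding⇒evenChromatic H χ′ (λ i j → cong (λ c → inject≤ c k≤) (χ-sym i j)) L↭
         (emb χ′ (m≤n⇒m≤1+n (m≤n⊔m k K)) (allFin⁺ n)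
           (subst₂ (λ l u → suc b * suc (k ⊔ K) ^ (l ∸ 2) ≤ b * u)
             (sym (trans (↭-length L↭) (length-tabulate {n = v H} id))) (sym (length-tabulate {n = n} id)) large)))

  colours-bound : ∀ b .{{_ : NonZero b}} K₀ → ∃ λ N → ∀ n → n ≥ N →
    rH-atLeast H n (λ k → K₀ ≤ k × b * n < suc b * k ^ m)
  colours-bound b K₀ with forced-copy b
  ... | K , forced = suc N , bound
    where
    N = suc b * suc (K ⊔ K₀) ^ m
    bound : ∀ n → n ≥ suc N → rH-atLeast H n (λ k → K₀ ≤ k × b * n < suc b * k ^ m)
    -- The threshold `suc N` makes n positive, and then a colouring needs at least one colour.
    bound (suc n) n≥N zero    χ χ-sym none with () ← χ zero zero
    bound n       n≥N (suc k) χ χ-sym none with ≤-total k (K ⊔ K₀)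
    ... | inj₁ k≤ = ⊥-elim (none (forced χ χ-sym (begin
      suc b * suc (k ⊔ K) ^ m      ≤⟨ *-monoʳ-≤ (suc b) (^-monoˡ-≤ m (s≤s (⊔-lub k≤ (m≤m⊔n K K₀)))) ⟩
      N                            ≤⟨ ≤-trans (n≤1+n N) n≥N ⟩
      n                            ≤⟨ m≤n*m n b ⟩
      b * n                        ∎)))
      where open ≤-Reasoning
    ... | inj₂ k≥ = m≤n⇒m≤1+n (≤-trans (m≤n⊔m K K₀) k≥) , ≰⇒> λ large → none (forced χ χ-sym
      (subst (λ k′ → suc b * suc k′ ^ m ≤ b * n) (sym (m≥n⇒m⊔n≡m (≤-trans (m≤m⊔n K K₀) k≥))) large))

-- With c = p/q, this is the bound n^(-c) on the density, raised to the power q to stay in ℕ.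
rH⇒dlin : ∀ H n p q → rH-atLeast H n (λ k → n ^ p ≤ k ^ q) →
  ∀ (C : Subspace n) → CopyFree H n C → ∣ C ∣ ^ q * n ^ p ≤ 2 ^ (q * edgesKn n)
rH⇒dlin H n p q r C free with coset-colouring C H free
... | k , χ , χ-sym , none , k∣C∣≤ = begin
  ∣ C ∣ ^ q * n ^ p          ≤⟨ *-monoʳ-≤ (∣ C ∣ ^ q) (r k χ χ-sym none) ⟩
  ∣ C ∣ ^ q * k ^ q          ≡⟨ *-comm (∣ C ∣ ^ q) (k ^ q) ⟩
  k ^ q * ∣ C ∣ ^ q          ≡⟨ ^-distribʳ-* k ∣ C ∣ q ⟨
  (k * ∣ C ∣) ^ q            ≤⟨ ^-monoˡ-≤ q k∣C∣≤ ⟩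
  (2 ^ edgesKn n) ^ q        ≡⟨ ^-*-assoc 2 (edgesKn n) q ⟩
  2 ^ (edgesKn n * q)        ≡⟨ cong (2 ^_) (*-comm (edgesKn n) q) ⟩
  2 ^ (q * edgesKn n)        ∎
  where open ≤-Reasoning

-- With ε = a/(b + 1) ≥ 1/(b + 1), the factor (1 - ε)^(m + 1) is at most (b/(b + 1))^(m + 1), hence
-- at most b/(b + 1), and the hypothesis bounds n · b/(b + 1) by k^(m + 1).
scale-bound : ∀ m a b n k → 0 < a → b * n < suc b * k ^ suc m →
              (suc b ∸ a) ^ suc m * n ≤ (k * suc b) ^ suc m
scale-bound m a@(suc a′) b n k _ small = begin
  (b ∸ a′) ^ suc m * n               ≤⟨ *-monoˡ-≤ n (^-monoˡ-≤ (suc m) (m∸n≤m b a′)) ⟩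
  b ^ suc m * n                      ≡⟨ eq b (b ^ m) n ⟩
  b ^ m * (b * n)                    ≤⟨ *-mono-≤ (^-monoˡ-≤ m (n≤1+n b)) (<⇒≤ small) ⟩
  suc b ^ m * (suc b * k ^ suc m)    ≡⟨ eq′ (suc b) (suc b ^ m) (k ^ suc m) ⟩
  k ^ suc m * suc b ^ suc m          ≡⟨ ^-distribʳ-* k (suc b) (suc m) ⟨
  (k * suc b) ^ suc m                ∎
  where
  open ≤-Reasoning
  eq : ∀ b P n → b * P * n ≡ P * (b * n)
  eq = solve-∀
  eq′ : ∀ b P Q → P * (b * Q) ≡ Q * (b * P)
  eq′ = solve-∀

theorem1p5 : (H : SimpleGraph) → EvenDecomposition H →
    (Σ ℕ λ p → Σ ℕ λ q → (0 < p) × (0 < q) × Σ ℕ λ N → ∀ n → n ≥ N →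
    rH-atLeast H n (λ k → n ^ p ≤ k ^ q) ×
    (∀ (C : Subspace n) → CopyFree H n C → ∣ C ∣ ^ q * n ^ p ≤ 2 ^ (q * edgesKn n)))
    ×
    (v H ≥ 3 → ∀ (a b : ℕ) → 0 < a → 0 < b → Σ ℕ λ N → ∀ n → n ≥ N →
    rH-atLeast H n (λ k → (b ∸ a) ^ (v H ∸ 2) * n ≤ (k * b) ^ (v H ∸ 2)))
theorem1p5 H D = polynomial , sharp
  where
  m = v H ∸ 2
  polynomial : Σ ℕ λ p → Σ ℕ λ q → (0 < p) × (0 < q) × Σ ℕ λ N → ∀ n → n ≥ N →
    rH-atLeast H n (λ k → n ^ p ≤ k ^ q) ×
    (∀ (C : Subspace n) → CopyFree H n C → ∣ C ∣ ^ q * n ^ p ≤ 2 ^ (q * edgesKn n))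
  -- Slack b = 1 gives n < 2k^m, and two colours at least let one more factor k absorb the 2; so the
  -- exponent obtained is 1/(m + 1).
  polynomial with colours-bound H D 1 2
  ... | N , bound = 1 , suc m , s≤s z≤n , s≤s z≤n , N , λ n n≥N →
    let r : rH-atLeast H n (λ k → n ^ 1 ≤ k ^ suc m)
        r k χ χ-sym none = let 2≤k , small = bound n n≥N k χ χ-sym none in begin
          n ^ 1          ≡⟨ trans (*-identityʳ n) (sym (*-identityˡ n)) ⟩
          1 * n          ≤⟨ <⇒≤ small ⟩
          2 * k ^ m      ≤⟨ *-monoˡ-≤ (k ^ m) 2≤k ⟩
          k ^ suc m      ∎
    in r , rH⇒dlin H n 1 (suc m) r
    where open ≤-Reasoning
  sharp : v H ≥ 3 → ∀ (a b : ℕ) → 0 < a → 0 < b → Σ ℕ λ N → ∀ n → n ≥ N →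
    rH-atLeast H n (λ k → (b ∸ a) ^ (v H ∸ 2) * n ≤ (k * b) ^ (v H ∸ 2))
  sharp v≥3 a b 0<a 0<b with v H ∸ 2 | m<n⇒0<n∸m v≥3 | (λ b → colours-bound H D (suc b) 0)
  -- Denominator 1 means ε ≥ 1, where the truncated difference makes the left side zero. Otherwise
  -- the slack parameter is the denominator minus one, which is positive.
  sharp v≥3 (suc a) (suc zero) 0<a 0<b | suc m′ | _ | _ = 0 , λ n _ k _ _ _ →
    subst (λ z → z ^ suc m′ * n ≤ (k * 1) ^ suc m′) (sym (0∸n≡0 a)) z≤n
  sharp v≥3 a (suc (suc b)) 0<a 0<b | suc m′ | _ | bounds with bounds b
  ... | N , bound = N , λ n n≥N k χ χ-sym none →
    scale-bound m′ a (suc b) n k 0<a (proj₂ (bound n n≥N k χ χ-sym none))
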